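{- There is an absolute constant $C$ such that the following holds. Let $n,h,k$ be positive integers and let $s\ge \max\{k,h^2k^2/n\}$. Every $3$-graph on $n$ vertices with $e\ge Csn^2$ edges contains at least $t=\min\{s,\sqrt{sn}/h,s^{1/3}n^{2/3}/(hk)\}$ vertex-disjoint copies of $\mathit{St}_3(h,k)$.
   Context: A $3$-graph is a $3$-uniform hypergraph. $\mathit{St}_3(h,k)$ is the $3$-graph with a vertex $v$ contained in all edges such that removing $v$ from every edge yields $h$ vertex-disjoint copies of the graph star $S_k$ (a star with $k$ leaves). Floors/ceilings of non-integer quantities are omitted.
   Formalization: The parameter s is taken to be a positive rational a/b instead of an arbitrary real number; "at least t copies" is stated as m disjoint copies for every natural number m ≤ t. -}

module Defs where

open import Data.Nat using (ℕ)
open import Data.Fin using (Fin)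
open import Data.Fin.Subset using (Subset; ⁅_⁆; _∪_; ∣_∣)
open import Data.List using (List; length)
open import Data.List.Relation.Unary.All using (All)
open import Data.List.Relation.Unary.Unique.Propositional using (Unique)
open import Data.List.Membership.Propositional using (_∈_)
open import Data.Product using (Σ; _×_)
open import Relation.Binary.PropositionalEquality using (_≡_)
open import Function.Definitions using (Injective)

record ThreeGraph (n : ℕ) : Set where
  field
    edges   : List (Subset n)
    uniform : All (λ e → ∣ e ∣ ≡ 3) edges
    simple  : Unique edges

open ThreeGraph public

numEdges : ∀ {n} → ThreeGraph n → ℕ
numEdges G = length (edges G)

HasEdge : ∀ {n} → ThreeGraph n → Fin n → Fin n → Fin n → Set
HasEdge G a b c = (⁅ a ⁆ ∪ ⁅ b ⁆ ∪ ⁅ c ⁆) ∈ edges G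

-- Vertices of St_3(h,k): the apex v, star centres c_i (i < h),
-- and leaves l_{i,j} (i < h, j < k).  Edges: {v, c_i, l_{i,j}}.
data StVert (h k : ℕ) : Set where
  apex   : StVert h k
  centre : Fin h → StVert h k
  leaf   : Fin h → Fin k → StVert h k

-- m pairwise vertex-disjoint copies of St_3(h,k) in G:
-- a jointly injective map (copy index, vertex of St_3(h,k)) ↦ vertex of G
-- (injectivity on each copy = embedding, across copies = disjointness)
-- such that every edge of each copy is an edge of G.
DisjointStars : ∀ {n} → ThreeGraph n → (h k m : ℕ) → Set
DisjointStars {n} G h k m =
  Σ (Fin m → StVert h k → Fin n) λ f →
    (∀ {c c' : Fin m} {x x' : StVert h k} → f c x ≡ f c' x' → (c ≡ c') × (x ≡ x'))
    × (∀ (c : Fin m) (i : Fin h) (j : Fin k) →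
         HasEdge G (f c apex) (f c (centre i)) (f c (leaf i j)))

{-# OPTIONS --safe #-}
module Submission where

-- Call a pair heavy if its codegree is at least B = m(1 + h(1 + k)), the number of vertices of
-- m copies.  Disjoint stars S_h in the graph of heavy pairs extend greedily to copies of
-- St₃(h,k), so if m of them do not exist, that graph has maximum degree at most h outside an
-- exceptional set A meeting few heavy pairs.  Discard the edges with a heavy pair meeting A and
-- those with two heavy pairs outside A.  Each remaining edge has at most one heavy pair; choose
-- as apex the vertex opposite to it (any vertex if there is none), so that the pairs at the apex
-- are light and all links have maximum degree at most B.  A vertex with a dense link can serve
-- as apex whatever B vertices are already used: m such vertices give m copies.  Otherwise the
-- few of them are set aside, and removing a maximal greedy family of copies among the rest
-- destroys few edges and leaves every link without h disjoint stars S_k, hence small.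
-- This bounds the number of edges by a constant times s n².

open import Defs
open import Data.Nat using (ℕ; _+_; _*_; _^_; _≤_)
open import Data.Product using (∃-syntax)

open import Data.Nat using (zero; suc; z≤n; s≤s; _<_; _≤?_; _≤ᵇ_; >-nonZero)
open import Data.Nat.Properties hiding (_≟_)
open import Data.Bool as Bool using (Bool; true; false; _∧_; _∨_; not; T)
open import Data.Bool.Properties using (∧-comm)
open import Data.Empty using (⊥-elim)
open import Data.Fin using (Fin; zero; suc; inject≤; _≟_)
import Data.Fin.Properties as Finₚ
open import Data.List using (List; []; _∷_; _++_; map; length; allFin; lookup; filter; tabulate; cartesianProduct)
open import Data.List.Properties using (length-map; length-++; length-tabulate; ++-assoc)
open import Data.List.Membership.Propositional using (_∈_; _∉_)
open import Data.List.Membership.Propositional.Properties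
open import Data.List.Relation.Unary.Any using (here; there)
open import Data.List.Relation.Unary.All as All using (All; []; _∷_)
open import Data.List.Relation.Unary.AllPairs using ([]; _∷_)
open import Data.List.Relation.Unary.Unique.Propositional using (Unique)
import Data.List.Relation.Unary.Unique.Propositional.Properties as Uniqueₚ
open import Data.Fin.Subset using (Subset; ⁅_⁆; _∪_; ∣_∣; ⊥)
open import Data.Fin.Subset.Properties using (∪-assoc; ∪-comm; ∪-idem; ∪-identityˡ; ∪-identityʳ; ∣⁅x⁆∣≡1)
open import Data.Vec using ([]; _∷_)
open import Data.Vec.Properties using (≡-dec)
open import Data.Maybe using (Maybe; nothing; just)
open import Data.Product using (Σ; ∃; _×_; _,_; proj₁; proj₂)
open import Data.Sum as Sum using (_⊎_; inj₁; inj₂)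
open import Function using (_∘_; id)
open import Function.Definitions using (Injective)
open import Relation.Binary.PropositionalEquality hiding (J)
open import Relation.Nullary using (¬_; Dec; yes; no; does; contradiction)
open import Relation.Nullary.Decidable using (dec-true; dec-false; from-yes)
open import Data.Nat.Tactic.RingSolver using (solve-∀)
open import Algebra.Properties.CommutativeMonoid.Sum +-0-commutativeMonoid using (∑-comm; ∑-distrib-+; sum-cong-≗) renaming (sum to ∑)

private
  variable
    n p q : ℕ
    I : Set

-- Finite sums and indicators

⟦_⟧ : Bool → ℕ
⟦ true ⟧  = 1
⟦ false ⟧ = 0

⟦⟧≤1 : ∀ b → ⟦ b ⟧ ≤ 1
⟦⟧≤1 true  = ≤-refl
⟦⟧≤1 false = z≤n

⟦⟧-mono : ∀ {a b} → (a ≡ true → b ≡ true) → ⟦ a ⟧ ≤ ⟦ b ⟧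
⟦⟧-mono {false} _ = z≤n
⟦⟧-mono {true} imp rewrite imp refl = ≤-refl

∧-elim : ∀ {a b} → a ∧ b ≡ true → a ≡ true × b ≡ true
∧-elim {true} e = refl , e

∑-mono : {f g : Fin n → ℕ} → (∀ i → f i ≤ g i) → ∑ f ≤ ∑ g
∑-mono {zero}  f≤g = z≤n
∑-mono {suc n} f≤g = +-mono-≤ (f≤g zero) (∑-mono (f≤g ∘ suc))

∑-mono-+ : {f g h : Fin n → ℕ} → (∀ i → f i ≤ g i + h i) → ∑ f ≤ ∑ g + ∑ h
∑-mono-+ {g = g} {h} f≤g+h = ≤-trans (∑-mono f≤g+h) (≤-reflexive (∑-distrib-+ g h))

∑-≤-const : {f : Fin n → ℕ} {c : ℕ} → (∀ i → f i ≤ c) → ∑ f ≤ n * c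
∑-≤-const {zero}  f≤c = z≤n
∑-≤-const {suc n} f≤c = +-mono-≤ (f≤c zero) (∑-≤-const (f≤c ∘ suc))

∑-≤0 : (f : Fin n → ℕ) → (∀ i → f i ≤ 0) → ∑ f ≤ 0
∑-≤0 {zero}  f f≤0 = z≤n
∑-≤0 {suc n} f f≤0 = +-mono-≤ (f≤0 zero) (∑-≤0 (f ∘ suc) (f≤0 ∘ suc))

∑-*ʳ : (f : Fin n → ℕ) (c : ℕ) → ∑ (λ i → f i * c) ≡ ∑ f * c
∑-*ʳ {zero}  f c = refl
∑-*ʳ {suc n} f c = trans (cong (f zero * c +_) (∑-*ʳ (f ∘ suc) c)) (sym (*-distribʳ-+ c (f zero) (∑ (f ∘ suc))))

term≤∑ : (f : Fin n → ℕ) (i : Fin n) → f i ≤ ∑ f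
term≤∑ f zero    = m≤m+n _ _
term≤∑ f (suc i) = ≤-trans (term≤∑ (f ∘ suc) i) (m≤n+m _ _)

module _ {n : ℕ} where
  open import Data.List.Membership.DecPropositional (_≟_ {n}) using (_∈?_)

  infix 7 _∈ᵇ_ _∉ᵇ_

  _∈ᵇ_ _∉ᵇ_ : Fin n → List (Fin n) → Bool
  x ∈ᵇ Z = does (x ∈? Z)
  x ∉ᵇ Z = not (x ∈ᵇ Z)

  ∈⇒∈ᵇ : ∀ {x Z} → x ∈ Z → x ∈ᵇ Z ≡ true
  ∈⇒∈ᵇ {x} {Z} = dec-true (x ∈? Z)

  ∉⇒∈ᵇ : ∀ {x Z} → x ∉ Z → x ∈ᵇ Z ≡ false
  ∉⇒∈ᵇ {x} {Z} = dec-false (x ∈? Z)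

  ∉ᵇ⇒∉ : ∀ {x Z} → x ∉ᵇ Z ≡ true → x ∉ Z
  ∉ᵇ⇒∉ e x∈Z rewrite ∈⇒∈ᵇ x∈Z with () ← e

∑-≟ : (z : Fin n) → ∑ (λ x → ⟦ does (x ≟ z) ⟧) ≤ 1
∑-≟ {suc n} zero    = s≤s (∑-≤0 {n} (λ _ → 0) (λ _ → z≤n))
∑-≟ {suc n} (suc z) = ∑-≟ z

⟦∨⟧ : ∀ a b → ⟦ a ∨ b ⟧ ≤ ⟦ a ⟧ + ⟦ b ⟧
⟦∨⟧ true  b = s≤s z≤n
⟦∨⟧ false b = ≤-refl

∑-∈ᵇ : (Z : List (Fin n)) → ∑ (λ x → ⟦ x ∈ᵇ Z ⟧) ≤ length Z
∑-∈ᵇ {n} []      = ∑-≤0 {n} (λ _ → 0) (λ _ → z≤n)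
∑-∈ᵇ     (z ∷ Z) = ≤-trans (∑-mono-+ (λ x → ⟦∨⟧ (does (x ≟ z)) (x ∈ᵇ Z))) (+-mono-≤ (∑-≟ z) (∑-∈ᵇ Z))

⟦⟧-split : ∀ a b → ⟦ a ⟧ ≤ ⟦ a ∧ not b ⟧ + ⟦ b ⟧
⟦⟧-split true  true  = ≤-refl
⟦⟧-split true  false = ≤-refl
⟦⟧-split false b     = z≤n

∑-avoid : (P : Fin n → Bool) (Z : List (Fin n)) → ∑ (λ x → ⟦ P x ⟧) ≤ ∑ (λ x → ⟦ P x ∧ x ∉ᵇ Z ⟧) + length Z
∑-avoid P Z = ≤-trans (∑-mono-+ (λ x → ⟦⟧-split (P x) (x ∈ᵇ Z))) (+-monoʳ-≤ _ (∑-∈ᵇ Z))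

-- With `A` the existence of a copy at a point and `B` the trace of a failed attempt there, this
-- yields one success or failure everywhere.
search : {A B : Fin n → Set} → (∀ x → A x ⊎ B x) → ∃ A ⊎ (∀ x → B x)
search {zero}  dec = inj₂ λ ()
search {suc n} dec with dec zero | search (dec ∘ suc)
... | inj₁ a | _            = inj₁ (zero , a)
... | inj₂ b | inj₁ (x , a) = inj₁ (suc x , a)
... | inj₂ b | inj₂ bs      = inj₂ λ { zero → b ; (suc x) → bs x }

-- At most `length Z` of the points counted by the sum can lie in `Z`.
exists-outside : (P : Fin n → Bool) (Z : List (Fin n)) → length Z < ∑ (λ x → ⟦ P x ⟧) → ∃ λ x → P x ≡ true × x ∉ Z
exists-outside {n} P Z lt with search {A = λ x → P x ∧ x ∉ᵇ Z ≡ true} {B = λ x → P x ∧ x ∉ᵇ Z ≡ false} (λ x → dec (P x ∧ x ∉ᵇ Z))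
  where
  dec : ∀ b → b ≡ true ⊎ b ≡ false
  dec true  = inj₁ refl
  dec false = inj₂ refl
... | inj₁ (x , e) = x , proj₁ (∧-elim e) , ∉ᵇ⇒∉ (proj₂ (∧-elim e))
... | inj₂ none    = contradiction (≤-trans lt (≤-trans (∑-avoid P Z) (+-monoˡ-≤ _ zero-sum))) (<-irrefl refl)
  where
  zero-sum : ∑ (λ x → ⟦ P x ∧ x ∉ᵇ Z ⟧) ≤ 0
  zero-sum = ∑-≤0 (λ x → ⟦ P x ∧ x ∉ᵇ Z ⟧) (λ x → ≤-reflexive (cong ⟦_⟧ (none x)))

-- Disjoint copies of a finite configuration

-- `Z` lists the vertices already occupied; avoiding it is what makes successive copies disjoint.
Copy : (I : Set) → ((I → Fin n) → Set) → List (Fin n) → Set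
Copy {n} I P Z = Σ (I → Fin n) λ f → Injective _≡_ _≡_ f × (∀ i → f i ∉ Z) × P f

Enum : Set → ℕ → Set
Enum I q = Σ (List I) λ is → length is ≡ q × (∀ i → i ∈ is)

enum-Fin : ∀ q → Enum (Fin q) q
enum-Fin q = allFin q , length-tabulate id , ∈-allFin

enum-Maybe : Enum I q → Enum (Maybe I) (suc q)
enum-Maybe (is , len , full) =
  nothing ∷ map just is , cong suc (trans (length-map just is) len) ,
  λ { nothing → here refl ; (just i) → there (∈-map⁺ just (full i)) }

enum-× : ∀ p → Enum I q → Enum (Fin p × I) (p * q)
enum-× {I} {q} p (is , len , full) =
  cartesianProduct (allFin p) is ,
  trans (length-product (allFin p)) (cong₂ _*_ (length-tabulate {n = p} id) len) ,
  λ (j , i) → ∈-cartesianProduct⁺ (∈-allFin j) (full i)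
  where
  length-product : ∀ {A : Set} (js : List A) → length (cartesianProduct js is) ≡ length js * length is
  length-product []       = refl
  length-product (j ∷ js) = trans (length-++ (map (j ,_) is)) (cong₂ _+_ (length-map (j ,_) is) (length-product js))

-- A family is one copy of the configuration indexed by `Fin p × I`: its injectivity covers both
-- embedding and disjointness.
Family : ∀ p (I : Set) → (Fin p → (I → Fin n) → Set) → List (Fin n) → Set
Family p I P = Copy (Fin p × I) λ F → ∀ j → P j λ i → F (j , i)

image : Enum I q → (I → Fin n) → List (Fin n)
image (is , _) f = map f is

length-image : (e : Enum I q) (f : I → Fin n) → length (image e f) ≡ q
length-image (is , len , _) f = trans (length-map f is) len

∈-image : (e : Enum I q) (f : I → Fin n) (i : I) → f i ∈ image e f
∈-image (_ , _ , full) f i = ∈-map⁺ f (full i)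

family-[] : {P : Fin 0 → (I → Fin n) → Set} (Z : List (Fin n)) → Family 0 I P Z
family-[] Z = (λ ()) , (λ { {()} }) , (λ ()) , λ ()

family-∷ : (e : Enum I q) {P : Fin (suc p) → (I → Fin n) → Set} {Z : List (Fin n)} →
           (c : Copy I (P zero) Z) → Family p I (P ∘ suc) (image e (proj₁ c) ++ Z) → Family (suc p) I P Z
family-∷ {I} {p = p} {n} e {P} {Z} (f , f-inj , f∉ , Pf) (F , F-inj , F∉ , PF) = H , H-inj , H∉ , PH
  where
  H : Fin (suc p) × I → Fin n
  H (zero  , i) = f i
  H (suc j , i) = F (j , i)

  f≢F : ∀ i j i′ → ¬ f i ≡ F (j , i′)
  f≢F i j i′ eq = F∉ (j , i′) (∈-++⁺ˡ (subst (_∈ image e f) eq (∈-image e f i)))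

  H-inj : Injective _≡_ _≡_ H
  H-inj {zero  , i} {zero   , i′} eq = cong (zero ,_) (f-inj eq)
  H-inj {zero  , i} {suc j′ , i′} eq = ⊥-elim (f≢F i j′ i′ eq)
  H-inj {suc j , i} {zero   , i′} eq = ⊥-elim (f≢F i′ j i (sym eq))
  H-inj {suc j , i} {suc j′ , i′} eq with refl ← F-inj eq = refl

  H∉ : ∀ x → H x ∉ Z
  H∉ (zero  , i) = f∉ i
  H∉ (suc j , i) = F∉ (j , i) ∘ ∈-++⁺ʳ (image e f)

  PH : ∀ j → P j λ i → H (j , i)
  PH zero    = Pf
  PH (suc j) = PF j

length-image-++ : (e : Enum I q) (f : I → Fin n) (Z : List (Fin n)) → length (image e f ++ Z) ≡ q + length Z
length-image-++ e f Z = trans (length-++ (image e f)) (cong (_+ length Z) (length-image e f))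

-- The final number of occupied vertices is at most `L`, so before each choice at least `q` of these
-- `L` places are still free, which is all that `pick` asks for.
choose-each : (e : Enum I q) {L : ℕ} (p : ℕ) {P : Fin p → (I → Fin n) → Set} →
              (∀ j Z → length Z + q ≤ L → Copy I (P j) Z) →
              ∀ Z → length Z + p * q ≤ L → Family p I P Z
choose-each e zero {P} pick Z le = family-[] {P = P} Z
choose-each {q = q} e {L} (suc p) {P} pick Z le =
  family-∷ e {P} c (choose-each e p (pick ∘ suc) _ le′)
  where
  c : Copy _ (P zero) Z
  c = pick zero Z (≤-trans (+-monoʳ-≤ (length Z) (m≤m+n q (p * q))) le)

  le′ : length (image e (proj₁ c) ++ Z) + p * q ≤ L
  le′ = ≤-trans (≤-reflexive (begin
    length (image e (proj₁ c) ++ Z) + p * q  ≡⟨ cong (_+ p * q) (length-image-++ e (proj₁ c) Z) ⟩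
    q + length Z + p * q                     ≡⟨ cong (_+ p * q) (+-comm q (length Z)) ⟩
    length Z + q + p * q                     ≡⟨ +-assoc (length Z) q (p * q) ⟩
    length Z + (q + p * q)                   ∎)) le
    where open ≡-Reasoning

-- When the search gets stuck, `W` consists of the vertices of the copies placed so far, of which
-- there are fewer than `p`.
greedy : (e : Enum I q) {P : (I → Fin n) → Set} {Stuck : List (Fin n) → Set} →
         (∀ Z → Copy I P Z ⊎ Stuck Z) → ∀ p Z →
         Family p I (λ _ → P) Z ⊎ ∃ λ W → length W ≤ p * q × Stuck (W ++ Z)
greedy e {P} find zero Z = inj₁ (family-[] {P = λ _ → P} Z)
greedy {q = q} e {P} {Stuck} find (suc p) Z with find Z
... | inj₂ stuck = inj₂ ([] , z≤n , stuck)
... | inj₁ c with greedy e find p (image e (proj₁ c) ++ Z)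
...   | inj₁ F = inj₁ (family-∷ e {P = λ _ → P} c F)
...   | inj₂ (W , W≤ , stuck) =
        inj₂ (W ++ X , W++X≤ , subst Stuck (sym (++-assoc W X Z)) stuck)
  where
  X = image e (proj₁ c)
  W++X≤ : length (W ++ X) ≤ q + p * q
  W++X≤ = ≤-trans (≤-reflexive (trans (length-++ W) (trans (cong (length W +_) (length-image e (proj₁ c))) (+-comm (length W) q))))
                  (+-monoʳ-≤ q W≤)

-- Copies grown from a root

Rooted : {n : ℕ} {I : Set} → (Fin n → (I → Fin n) → Set) → (Maybe I → Fin n) → Set
Rooted P f = P (f nothing) (f ∘ just)

add-root : {P : Fin n → (I → Fin n) → Set} {Z : List (Fin n)} (r : Fin n) → r ∉ Z →
           Copy I (P r) (r ∷ Z) → Copy (Maybe I) (Rooted P) Z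
add-root {n} {I} {P} {Z} r r∉Z (f , f-inj , f∉ , Pf) = H , H-inj , H∉ , Pf
  where
  H : Maybe I → Fin n
  H nothing  = r
  H (just i) = f i

  H-inj : Injective _≡_ _≡_ H
  H-inj {nothing} {nothing} eq = refl
  H-inj {nothing} {just i}  eq = ⊥-elim (f∉ i (here (sym eq)))
  H-inj {just i}  {nothing} eq = ⊥-elim (f∉ i (here eq))
  H-inj {just i}  {just i′} eq = cong just (f-inj eq)

  H∉ : ∀ i → H i ∉ Z
  H∉ nothing  = r∉Z
  H∉ (just i) = f∉ i ∘ there

-- All roots are reserved beforehand: the rest of every copy avoids the whole list of roots, not
-- only its own.
add-roots : {P : Fin n → (I → Fin n) → Set} (roots : Fin p → Fin n) → Injective _≡_ _≡_ roots →
            Family p I (λ j → P (roots j)) (tabulate roots) → Family p (Maybe I) (λ _ → Rooted P) []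
add-roots {n} {I} {p} {P} roots roots-inj (F , F-inj , F∉ , PF) = H , H-inj , (λ _ ()) , PF
  where
  H : Fin p × Maybe I → Fin n
  H (j , nothing) = roots j
  H (j , just i)  = F (j , i)

  root≢F : ∀ j x → ¬ roots j ≡ F x
  root≢F j x eq = F∉ x (subst (_∈ tabulate roots) eq (∈-tabulate⁺ j))

  H-inj : Injective _≡_ _≡_ H
  H-inj {j , nothing} {j′ , nothing} eq = cong (_, nothing) (roots-inj eq)
  H-inj {j , nothing} {j′ , just i}  eq = ⊥-elim (root≢F j (j′ , i) eq)
  H-inj {j , just i}  {j′ , nothing} eq = ⊥-elim (root≢F j′ (j , i) (sym eq))
  H-inj {j , just i}  {j′ , just i′} eq with refl ← F-inj eq = refl

lookup-injective : ∀ {A : Set} {xs : List A} → Unique xs → ∀ i j → lookup xs i ≡ lookup xs j → i ≡ j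
lookup-injective (x∉ ∷ u) zero    zero    eq = refl
lookup-injective (x∉ ∷ u) zero    (suc j) eq = contradiction eq (All.lookup x∉ (∈-lookup j))
lookup-injective (x∉ ∷ u) (suc i) zero    eq = contradiction (sym eq) (All.lookup x∉ (∈-lookup i))
lookup-injective (x∉ ∷ u) (suc i) (suc j) eq = cong suc (lookup-injective u i j eq)

-- `Sparse r Z` is what a failed search at the root `r` outside `Z` leaves behind. Since `p * suc q`
-- counts the vertices of `p` rooted copies, `robust` says that a big root can still be served when
-- its own vertex and all vertices of the other copies are occupied.
module _ {n q : ℕ} {I : Set} (e : Enum I q)
         (P : Fin n → (I → Fin n) → Set) (Sparse : Fin n → List (Fin n) → Set)
         (find : ∀ r Z → Copy I (P r) (r ∷ Z) ⊎ Sparse r Z)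
         (p : ℕ) (big : Fin n → Bool)
         (robust : ∀ r Z → big r ≡ true → length Z + q ≤ p * suc q → ¬ Sparse r Z) where

  private
    bigs : List (Fin n)
    bigs = filter (λ r → big r Bool.≟ true) (allFin n)

  -- If p roots are big, they are all reserved and served one after another;
  -- otherwise the few big roots are set aside and the search runs greedily.
  many-or-sparse : Family p (Maybe I) (λ _ → Rooted P) [] ⊎
    ∃ λ R → ∃ λ W → length R ≤ p × length W ≤ p * suc q ×
      (∀ r → big r ≡ true → r ∈ R) × (∀ r → r ∉ W ++ R → Sparse r (W ++ R))
  many-or-sparse with p ≤? length bigs
  ... | yes p≤ = inj₁ (add-roots {P = P} roots roots-inj
      (choose-each e p from-big (tabulate roots)
        (≤-reflexive (trans (cong (_+ p * q) (length-tabulate roots)) (sym (*-suc p q))))))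
    where
    roots : Fin p → Fin n
    roots j = lookup bigs (inject≤ j p≤)

    roots-inj : Injective _≡_ _≡_ roots
    roots-inj eq = Finₚ.inject≤-injective p≤ p≤ _ _
      (lookup-injective (Uniqueₚ.filter⁺ (λ r → big r Bool.≟ true) (Uniqueₚ.allFin⁺ n)) _ _ eq)

    roots-big : ∀ j → big (roots j) ≡ true
    roots-big j = proj₂ (∈-filter⁻ (λ r → big r Bool.≟ true) {xs = allFin n} (∈-lookup (inject≤ j p≤)))

    from-big : ∀ j Z → length Z + q ≤ p * suc q → Copy I (P (roots j)) Z
    from-big j Z le with find (roots j) Z
    ... | inj₁ (f , f-inj , f∉ , Pf) = f , f-inj , (λ i → f∉ i ∘ there) , Pf
    ... | inj₂ sparse = contradiction sparse (robust _ Z (roots-big j) le)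
  ... | no p≰ with greedy (enum-Maybe e) search-root p bigs
    where
    open import Data.List.Membership.DecPropositional (_≟_ {n}) using (_∈?_)

    search-root : ∀ Z → Copy (Maybe I) (Rooted P) Z ⊎ (∀ r → r ∉ Z → Sparse r Z)
    search-root Z with search {A = λ _ → Copy (Maybe I) (Rooted P) Z} {B = λ r → r ∉ Z → Sparse r Z} at-root
      where
      at-root : ∀ r → Copy (Maybe I) (Rooted P) Z ⊎ (r ∉ Z → Sparse r Z)
      at-root r with r ∈? Z | find r Z
      ... | yes r∈Z | _           = inj₂ (contradiction r∈Z)
      ... | no _    | inj₂ sparse = inj₂ λ _ → sparse
      ... | no r∉Z  | inj₁ c      = inj₁ (add-root {P = P} r r∉Z c)
    ... | inj₁ (_ , c) = inj₁ c
    ... | inj₂ sparse  = inj₂ sparse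
  ...   | inj₁ (F , F-inj , _ , PF) = inj₁ (F , F-inj , (λ _ ()) , PF)
  ...   | inj₂ (W , W≤ , sparse) =
          inj₂ (_ , W , <⇒≤ (≰⇒> p≰) , W≤ ,
                (λ r b → ∈-filter⁺ (λ r → big r Bool.≟ true) (∈-allFin r) b) , sparse)

pick : (P : Fin n → Bool) (Z : List (Fin n)) (k : ℕ) → length Z + k ≤ ∑ (λ x → ⟦ P x ⟧) →
       Copy (Fin k) (λ f → ∀ i → P (f i) ≡ true) Z
pick P Z zero    le = (λ ()) , (λ { {()} }) , (λ ()) , λ ()
pick {n} P Z (suc k) le with exists-outside P Z (≤-trans (s≤s (m≤m+n _ k)) (≤-trans (≤-reflexive (sym (+-suc (length Z) k))) le))
... | x , Px , x∉Z with pick P (x ∷ Z) k (≤-trans (≤-reflexive (sym (+-suc (length Z) k))) le)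
...   | f , f-inj , f∉ , Pf = H , H-inj , H∉ , PH
  where
  H : Fin (suc k) → Fin n
  H zero    = x
  H (suc i) = f i

  H-inj : Injective _≡_ _≡_ H
  H-inj {zero}  {zero}  eq = refl
  H-inj {zero}  {suc i} eq = ⊥-elim (f∉ i (here (sym eq)))
  H-inj {suc i} {zero}  eq = ⊥-elim (f∉ i (here eq))
  H-inj {suc i} {suc j} eq = cong suc (f-inj eq)

  H∉ : ∀ i → H i ∉ Z
  H∉ zero    = x∉Z
  H∉ (suc i) = f∉ i ∘ there

  PH : ∀ i → P (H i) ≡ true
  PH zero    = Px
  PH (suc i) = Pf i

-- Disjoint stars in a graph

∑-guard : (a : Bool) (f : Fin n → Bool) → ∑ (λ x → ⟦ a ∧ f x ⟧) ≤ ⟦ a ⟧ * ∑ (λ x → ⟦ f x ⟧)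
∑-guard true  f = ≤-reflexive (sym (+-identityʳ _))
∑-guard {n} false f = ∑-≤0 {n} (λ _ → 0) (λ _ → z≤n)

∑-over : (Z : List (Fin n)) (f : Fin n → ℕ) {c : ℕ} → (∀ x → f x ≤ c) → ∑ (λ x → ⟦ x ∈ᵇ Z ⟧ * f x) ≤ length Z * c
∑-over Z f {c} f≤c = ≤-trans (∑-mono λ x → *-monoʳ-≤ ⟦ x ∈ᵇ Z ⟧ (f≤c x))
  (≤-trans (≤-reflexive (∑-*ʳ (λ x → ⟦ x ∈ᵇ Z ⟧) c)) (*-monoˡ-≤ c (∑-∈ᵇ Z)))

-- Intended for a short list `R` of vertices with a large value of `f`, and a longer list `W` of
-- vertices which, outside `R`, have a small one.
∑-over-++ : (W R : List (Fin n)) (f : Fin n → ℕ) {a b : ℕ} → (∀ x → f x ≤ a) → (∀ x → x ∉ R → f x ≤ b) →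
            ∑ (λ x → ⟦ x ∈ᵇ (W ++ R) ⟧ * f x) ≤ length R * a + length W * b
∑-over-++ {n} W R f {a} {b} f≤a f≤b = ≤-trans (∑-mono-+ pointwise) (+-mono-≤ (∑-over R (λ _ → a) (λ _ → ≤-refl)) (∑-over W (λ _ → b) (λ _ → ≤-refl)))
  where
  open import Data.List.Membership.DecPropositional (_≟_ {n}) using (_∈?_)

  pointwise : ∀ x → ⟦ x ∈ᵇ (W ++ R) ⟧ * f x ≤ ⟦ x ∈ᵇ R ⟧ * a + ⟦ x ∈ᵇ W ⟧ * b
  pointwise x with x ∈? R
  ... | yes x∈R rewrite ∈⇒∈ᵇ (∈-++⁺ʳ W x∈R) = ≤-trans (+-monoˡ-≤ 0 (f≤a x)) (m≤m+n _ _)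
  ... | no x∉R with x ∈? W
  ...   | yes x∈W rewrite ∈⇒∈ᵇ (∈-++⁺ˡ {ys = R} x∈W) = +-monoˡ-≤ 0 (f≤b x x∉R)
  ...   | no x∉W rewrite ∉⇒∈ᵇ {x = x} {W ++ R} (λ x∈ → Sum.[ x∉W , x∉R ] (∈-++⁻ W x∈)) = z≤n

degree : (Fin n → Fin n → Bool) → Fin n → ℕ
degree g x = ∑ λ y → ⟦ g x y ⟧

Star : (Fin n → Fin n → Bool) → Fin n → (Fin q → Fin n) → Set
Star g r f = ∀ i → g r (f i) ≡ true

Stars : (Fin n → Fin n → Bool) → (p q : ℕ) → List (Fin n) → Set
Stars g p q = Family p (Maybe (Fin q)) λ _ → Rooted (Star g)

-- A vertex of degree at least `p * suc q` stays the centre of a star after the other stars are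
-- removed, so it counts as big. If the stars do not exist, `A` consists of at most `p` vertices,
-- including all big ones, with degree at most `Δ`, and of at most `p * suc q` vertices from a stuck
-- greedy family; those among the latter that are not big have degree at most `p * suc q`.
stars-or-sparse : (g : Fin n → Fin n → Bool) → (∀ x → g x x ≡ false) →
                  {Δ : ℕ} → (∀ x → degree g x ≤ Δ) → (p q : ℕ) →
                  Stars g p q [] ⊎ ∃ λ A →
                    ∑ (λ x → ⟦ x ∈ᵇ A ⟧ * degree g x) ≤ p * Δ + (p * suc q) * (p * suc q) ×
                    (∀ x → x ∉ A → ∑ (λ y → ⟦ g x y ∧ y ∉ᵇ A ⟧) ≤ q)
stars-or-sparse {n} g irr {Δ} deg≤ p q with many-or-sparse (enum-Fin q) (Star g) Sparse find p (λ r → p * suc q ≤ᵇ degree g r) robust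
  where
  Sparse : Fin n → List (Fin n) → Set
  Sparse r Z = ∑ (λ y → ⟦ g r y ∧ y ∉ᵇ Z ⟧) < q

  find : ∀ r Z → Copy (Fin q) (Star g r) (r ∷ Z) ⊎ Sparse r Z
  find r Z with q ≤? ∑ (λ y → ⟦ g r y ∧ y ∉ᵇ Z ⟧)
  ... | no q≰  = inj₂ (≰⇒> q≰)
  -- The predicate already excludes `Z`, and irreflexivity of `g` excludes `r`, so the list of
  -- forbidden vertices may be empty.
  ... | yes q≤ with pick (λ y → g r y ∧ y ∉ᵇ Z) [] q q≤
  ...   | f , f-inj , _ , Pf = inj₁ (f , f-inj , f∉ , proj₁ ∘ ∧-elim ∘ Pf)
    where
    f∉ : ∀ i → f i ∉ r ∷ Z
    f∉ i (here fi≡r)  with () ← trans (sym (irr r)) (subst (λ y → g r y ≡ true) fi≡r (proj₁ (∧-elim (Pf i))))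
    f∉ i (there fi∈Z) = ∉ᵇ⇒∉ (proj₂ (∧-elim {g r (f i)} (Pf i))) fi∈Z

  robust : ∀ r Z → (p * suc q ≤ᵇ degree g r) ≡ true → length Z + q ≤ p * suc q → ¬ Sparse r Z
  robust r Z b le sparse = <-irrefl refl (begin-strict
    degree g r                                    ≤⟨ ∑-avoid (g r) Z ⟩
    ∑ (λ y → ⟦ g r y ∧ y ∉ᵇ Z ⟧) + length Z       <⟨ +-monoˡ-< (length Z) sparse ⟩
    q + length Z                                  ≡⟨ +-comm q (length Z) ⟩
    length Z + q                                  ≤⟨ le ⟩
    p * suc q                                     ≤⟨ ≤ᵇ⇒≤ _ _ (subst T (sym b) _) ⟩
    degree g r                                    ∎)
    where open ≤-Reasoning
... | inj₁ stars = inj₁ stars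
... | inj₂ (R , W , R≤ , W≤ , big∈R , sparse) = inj₂ (W ++ R , touching , λ x x∉ → <⇒≤ (sparse x x∉))
  where
  small : ∀ x → x ∉ R → degree g x ≤ p * suc q
  small x x∉R with p * suc q ≤? degree g x in eq
  ... | yes _  = contradiction (big∈R x (cong does eq)) x∉R
  ... | no big = <⇒≤ (≰⇒> big)

  touching : ∑ (λ x → ⟦ x ∈ᵇ (W ++ R) ⟧ * degree g x) ≤ p * Δ + (p * suc q) * (p * suc q)
  touching = ≤-trans (∑-over-++ W R (degree g) deg≤ small) (+-mono-≤ (*-monoˡ-≤ Δ R≤) (*-monoˡ-≤ (p * suc q) W≤))

edges-touching : (g : Fin n → Fin n → Bool) (A : List (Fin n)) →
                 ∑ (λ x → ∑ λ y → ⟦ x ∈ᵇ A ∧ g x y ⟧) ≤ ∑ (λ x → ⟦ x ∈ᵇ A ⟧ * degree g x)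
edges-touching g A = ∑-mono λ x → ∑-guard (x ∈ᵇ A) (g x)

edge-split : ∀ g a b → ⟦ g ⟧ ≤ ⟦ a ∧ g ⟧ + (⟦ b ∧ g ⟧ + ⟦ not a ∧ (g ∧ not b) ⟧)
edge-split false _     _     = z≤n
edge-split true  true  _     = s≤s z≤n
edge-split true  false true  = s≤s z≤n
edge-split true  false false = s≤s z≤n

-- Edges are counted as ordered pairs: an exceptional vertex can be either end, hence the factor 2,
-- and every other vertex has at most `q` neighbours outside the exceptional set.
sparseBound : (n Δ p q : ℕ) → ℕ
sparseBound n Δ p q = 2 * (p * Δ + (p * suc q) * (p * suc q)) + n * q

stars-or-few-edges : (g : Fin n → Fin n → Bool) → (∀ x → g x x ≡ false) → (∀ x y → g x y ≡ g y x) →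
                     {Δ : ℕ} → (∀ x → degree g x ≤ Δ) → (p q : ℕ) →
                     Stars g p q [] ⊎ ∑ (degree g) ≤ sparseBound n Δ p q
stars-or-few-edges {n} g irr g-sym {Δ} deg≤ p q with stars-or-sparse g irr deg≤ p q
... | inj₁ stars = inj₁ stars
... | inj₂ (A , touching , sparse) = inj₂ (begin
  ∑ (λ x → ∑ λ y → ⟦ g x y ⟧)
    ≤⟨ (∑-mono λ x → ≤-trans (∑-mono-+ λ y → edge-split (g x y) (x ∈ᵇ A) (y ∈ᵇ A)) (+-monoʳ-≤ _ (≤-reflexive (∑-distrib-+ (λ y → ⟦ y ∈ᵇ A ∧ g x y ⟧) _)))) ⟩
  ∑ (λ x → ∑ (λ y → ⟦ x ∈ᵇ A ∧ g x y ⟧) + (∑ (λ y → ⟦ y ∈ᵇ A ∧ g x y ⟧) + ∑ (λ y → ⟦ x ∉ᵇ A ∧ (g x y ∧ y ∉ᵇ A) ⟧)))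
    ≡⟨ trans (∑-distrib-+ (λ x → ∑ (λ y → ⟦ x ∈ᵇ A ∧ g x y ⟧)) _) (cong (∑ (λ x → ∑ (λ y → ⟦ x ∈ᵇ A ∧ g x y ⟧)) +_) (∑-distrib-+ (λ x → ∑ (λ y → ⟦ y ∈ᵇ A ∧ g x y ⟧)) _)) ⟩
  ∑ (λ x → ∑ λ y → ⟦ x ∈ᵇ A ∧ g x y ⟧) + (∑ (λ x → ∑ λ y → ⟦ y ∈ᵇ A ∧ g x y ⟧) + ∑ (λ x → ∑ λ y → ⟦ x ∉ᵇ A ∧ (g x y ∧ y ∉ᵇ A) ⟧))
    ≤⟨ +-mono-≤ first (+-mono-≤ second third) ⟩
  M + (M + n * q)
    ≡⟨ sym (+-assoc M M (n * q)) ⟩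
  M + M + n * q
    ≡⟨ cong (λ t → M + t + n * q) (sym (+-identityʳ M)) ⟩
  2 * M + n * q ∎)
  where
  open ≤-Reasoning

  M : ℕ
  M = p * Δ + (p * suc q) * (p * suc q)

  first : ∑ (λ x → ∑ λ y → ⟦ x ∈ᵇ A ∧ g x y ⟧) ≤ M
  first = ≤-trans (edges-touching g A) touching

  second : ∑ (λ x → ∑ λ y → ⟦ y ∈ᵇ A ∧ g x y ⟧) ≤ M
  second = begin
    ∑ (λ x → ∑ λ y → ⟦ y ∈ᵇ A ∧ g x y ⟧) ≡⟨ ∑-comm (λ x y → ⟦ y ∈ᵇ A ∧ g x y ⟧) ⟩
    ∑ (λ y → ∑ λ x → ⟦ y ∈ᵇ A ∧ g x y ⟧) ≡⟨ (sum-cong-≗ λ y → sum-cong-≗ λ x → cong (λ b → ⟦ y ∈ᵇ A ∧ b ⟧) (g-sym x y)) ⟩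
    ∑ (λ y → ∑ λ x → ⟦ y ∈ᵇ A ∧ g y x ⟧) ≤⟨ first ⟩
    M ∎

  row : ∀ x → ∑ (λ y → ⟦ x ∉ᵇ A ∧ (g x y ∧ y ∉ᵇ A) ⟧) ≤ q
  row x with x ∈ᵇ A in eq
  ... | true  = ≤-trans (∑-≤0 {n} (λ _ → 0) (λ _ → z≤n)) z≤n
  ... | false = sparse x (∉ᵇ⇒∉ (cong not eq))

  third : ∑ (λ x → ∑ λ y → ⟦ x ∉ᵇ A ∧ (g x y ∧ y ∉ᵇ A) ⟧) ≤ n * q
  third = ∑-≤-const row

restrict : List (Fin n) → (Fin n → Fin n → Bool) → Fin n → Fin n → Bool
restrict Z g x y = g x y ∧ (x ∉ᵇ Z ∧ y ∉ᵇ Z)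

-- Every vertex of a star in the restricted graph lies on an edge of that graph, hence outside `Z`.
-- For a centre this edge comes from its first leaf, whence `1 ≤ q`.
stars-outside : (g : Fin n → Fin n → Bool) → (∀ x → g x x ≡ false) → (∀ x y → g x y ≡ g y x) →
                {Δ : ℕ} → (∀ x → degree g x ≤ Δ) → (p q : ℕ) → 1 ≤ q → (Z : List (Fin n)) →
                Stars g p q Z ⊎ ∑ (degree (restrict Z g)) ≤ sparseBound n Δ p q
stars-outside {n} g irr g-sym {Δ} deg≤ p (suc q) _ Z
  with stars-or-few-edges (restrict Z g) (λ x → cong (_∧ (x ∉ᵇ Z ∧ x ∉ᵇ Z)) (irr x))
         (λ x y → cong₂ _∧_ (g-sym x y) (∧-comm (x ∉ᵇ Z) (y ∉ᵇ Z)))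
         (λ x → ≤-trans (∑-mono {n} λ y → ⟦⟧-mono {restrict Z g x y} {g x y} (proj₁ ∘ ∧-elim)) (deg≤ x)) p (suc q)
... | inj₂ few = inj₂ few
... | inj₁ (F , F-inj , _ , PF) = inj₁ (F , F-inj , F∉ , λ j i → proj₁ (∧-elim (PF j i)))
  where
  ends : ∀ j i → F (j , nothing) ∉ᵇ Z ≡ true × F (j , just i) ∉ᵇ Z ≡ true
  ends j i = ∧-elim (proj₂ (∧-elim {g (F (j , nothing)) (F (j , just i))} (PF j i)))

  F∉ : ∀ x → F x ∉ Z
  F∉ (j , nothing) = ∉ᵇ⇒∉ (proj₁ (ends j zero))
  F∉ (j , just i)  = ∉ᵇ⇒∉ (proj₂ (ends j i))

-- Triple sums

∑₂ : (Fin n → Fin n → ℕ) → ℕ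
∑₂ φ = ∑ λ x → ∑ λ y → φ x y

∑₃ : (Fin n → Fin n → Fin n → ℕ) → ℕ
∑₃ φ = ∑ λ x → ∑ λ y → ∑ λ z → φ x y z

∑₃-mono : {φ ψ : Fin n → Fin n → Fin n → ℕ} → (∀ x y z → φ x y z ≤ ψ x y z) → ∑₃ φ ≤ ∑₃ ψ
∑₃-mono φ≤ψ = ∑-mono λ x → ∑-mono λ y → ∑-mono λ z → φ≤ψ x y z

∑₂-+ : (φ ψ : Fin n → Fin n → ℕ) → ∑₂ (λ x y → φ x y + ψ x y) ≡ ∑₂ φ + ∑₂ ψ
∑₂-+ φ ψ = trans (sum-cong-≗ λ x → ∑-distrib-+ (φ x) (ψ x)) (∑-distrib-+ (λ x → ∑ (φ x)) (λ x → ∑ (ψ x)))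

∑₃-+ : (φ ψ : Fin n → Fin n → Fin n → ℕ) → ∑₃ (λ x y z → φ x y z + ψ x y z) ≡ ∑₃ φ + ∑₃ ψ
∑₃-+ φ ψ = trans (sum-cong-≗ λ x → ∑₂-+ (φ x) (ψ x)) (∑-distrib-+ (λ x → ∑₂ (φ x)) (λ x → ∑₂ (ψ x)))

∑₃-swap₁₂ : (φ : Fin n → Fin n → Fin n → ℕ) → ∑₃ (λ x y z → φ y x z) ≡ ∑₃ φ
∑₃-swap₁₂ φ = ∑-comm (λ x y → ∑ (φ y x))

∑₃-swap₂₃ : (φ : Fin n → Fin n → Fin n → ℕ) → ∑₃ (λ x y z → φ x z y) ≡ ∑₃ φ
∑₃-swap₂₃ φ = sum-cong-≗ λ x → ∑-comm (λ y z → φ x z y)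

∑₃-rotate : (φ : Fin n → Fin n → Fin n → ℕ) → ∑₃ (λ x y z → φ z x y) ≡ ∑₃ φ
∑₃-rotate φ = trans (∑₃-swap₂₃ (λ x z y → φ z x y)) (∑₃-swap₁₂ φ)

∑₃-const₁ : (φ : Fin n → Fin n → ℕ) → ∑₃ (λ z x y → φ x y) ≤ n * ∑₂ φ
∑₃-const₁ {n} φ = ∑-≤-const {n} λ _ → ≤-refl

∑₃-const₃ : (φ : Fin n → Fin n → ℕ) → ∑₃ (λ x y z → φ x y) ≤ n * ∑₂ φ
∑₃-const₃ φ = ≤-trans (≤-reflexive (∑₃-rotate (λ z x y → φ x y))) (∑₃-const₁ φ)

-- A vertex of `Z` lies on at most `Δ` ordered pairs in the first position and as many in the
-- second.
∑₂-restrict : (g : Fin n → Fin n → Bool) → (∀ x y → g x y ≡ g y x) → {Δ : ℕ} → (∀ x → degree g x ≤ Δ) →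
              ∀ Z → ∑ (degree g) ≤ ∑ (degree (restrict Z g)) + (length Z * Δ + length Z * Δ)
∑₂-restrict {n} g g-sym {Δ} deg≤ Z = begin
  ∑₂ (λ x y → ⟦ g x y ⟧)
    ≤⟨ (∑-mono λ x → ∑-mono λ y → split (g x y) (x ∈ᵇ Z) (y ∈ᵇ Z)) ⟩
  ∑₂ (λ x y → ⟦ restrict Z g x y ⟧ + (⟦ x ∈ᵇ Z ∧ g x y ⟧ + ⟦ y ∈ᵇ Z ∧ g x y ⟧))
    ≡⟨ trans (∑₂-+ (λ x y → ⟦ restrict Z g x y ⟧) _) (cong (∑ (degree (restrict Z g)) +_) (∑₂-+ (λ x y → ⟦ x ∈ᵇ Z ∧ g x y ⟧) _)) ⟩
  ∑ (degree (restrict Z g)) + (∑₂ (λ x y → ⟦ x ∈ᵇ Z ∧ g x y ⟧) + ∑₂ (λ x y → ⟦ y ∈ᵇ Z ∧ g x y ⟧))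
    ≤⟨ +-monoʳ-≤ (∑ (degree (restrict Z g))) (+-mono-≤ touching (≤-trans (≤-reflexive mirrored) touching)) ⟩
  ∑ (degree (restrict Z g)) + (length Z * Δ + length Z * Δ) ∎
  where
  open ≤-Reasoning

  split : ∀ e a b → ⟦ e ⟧ ≤ ⟦ e ∧ (not a ∧ not b) ⟧ + (⟦ a ∧ e ⟧ + ⟦ b ∧ e ⟧)
  split false _     _     = z≤n
  split true  true  _     = s≤s z≤n
  split true  false true  = s≤s z≤n
  split true  false false = s≤s z≤n

  touching : ∑₂ (λ x y → ⟦ x ∈ᵇ Z ∧ g x y ⟧) ≤ length Z * Δ
  touching = ≤-trans (edges-touching g Z) (∑-over Z (degree g) deg≤)

  mirrored : ∑₂ (λ x y → ⟦ y ∈ᵇ Z ∧ g x y ⟧) ≡ ∑₂ (λ x y → ⟦ x ∈ᵇ Z ∧ g x y ⟧)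
  mirrored = trans (∑-comm (λ x y → ⟦ y ∈ᵇ Z ∧ g x y ⟧))
                   (sum-cong-≗ λ y → sum-cong-≗ λ x → cong (λ b → ⟦ y ∈ᵇ Z ∧ b ⟧) (g-sym x y))

-- Makes statements about finitely many flags decidable, so that the case distinctions below are
-- settled by evaluating all cases.
all-Bool? : {P : Bool → Set} → (∀ b → Dec (P b)) → Dec (∀ b → P b)
all-Bool? P? with P? true | P? false
... | yes t | yes f = yes λ { true → t ; false → f }
... | no ¬t | _     = no λ all → ¬t (all true)
... | _     | no ¬f = no λ all → ¬f (all false)

-- Triples with a designated vertex c: the flags say whether uv is an edge of the link of c,
-- whether the pairs cu, cv, uv are heavy, and whether c, u, v lie in the exceptional set.
usable : (e cu cv uv au av : Bool) → Bool
usable e cu cv uv au av = e ∧ (not cu ∧ (not cv ∧ not (uv ∧ (au ∨ av))))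

-- A heavy pair with both ends outside the exceptional set; every vertex lies in at most `h` of
-- these.
sparse-pair : (cu ac au : Bool) → Bool
sparse-pair cu ac au = not ac ∧ (cu ∧ not au)

-- The triple is charged to `c` once for each heavy pair at an exceptional `c`, once if both pairs
-- at `c` are heavy outside the exceptional set, and once if `c` can be its apex.
charge : (e cu cv uv ac au av : Bool) → ℕ
charge e cu cv uv ac au av =
  ⟦ ac ∧ cu ⟧ + (⟦ ac ∧ cv ⟧ + (⟦ sparse-pair cu ac au ∧ sparse-pair cv ac av ⟧ + ⟦ usable e cu cv uv au av ⟧))

-- A heavy pair meeting the exceptional set is charged to its exceptional end, and two heavy pairs
-- outside that set to their common vertex. Otherwise at most one pair is heavy, and the triple is
-- usable at the opposite vertex, or at any vertex if no pair is heavy.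
charge-covers : ∀ e xy xz yz ax ay az →
  ⟦ e ⟧ ≤ charge e xy xz yz ax ay az + (charge e xy yz xz ay ax az + charge e xz yz xy az ax ay)
charge-covers = from-yes
  (all-Bool? λ e → all-Bool? λ xy → all-Bool? λ xz → all-Bool? λ yz → all-Bool? λ ax → all-Bool? λ ay → all-Bool? λ az →
    ⟦ e ⟧ ≤? charge e xy xz yz ax ay az + (charge e xy yz xz ay ax az + charge e xz yz xy az ax ay))

usable-sym : ∀ e cu cv uv au av → usable e cu cv uv au av ≡ usable e cv cu uv av au
usable-sym = from-yes
  (all-Bool? λ e → all-Bool? λ cu → all-Bool? λ cv → all-Bool? λ uv → all-Bool? λ au → all-Bool? λ av →
    usable e cu cv uv au av Bool.≟ usable e cv cu uv av au)

-- If tu holds, the triple is charged to u as its apex, which is allowed unless uv is heavy.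
usable-split : ∀ e cu cv uv ac au av tc tu tv →
  ⟦ usable e cu cv uv au av ⟧ ≤
    ⟦ tc ∧ usable e cu cv uv au av ⟧ +
    ((⟦ tu ∧ usable e cu uv cv ac av ⟧ + ⟦ tu ∧ sparse-pair uv au av ⟧) +
    ((⟦ tv ∧ usable e cv uv cu ac au ⟧ + ⟦ tv ∧ sparse-pair uv av au ⟧) +
    ⟦ not tc ∧ (usable e cu cv uv au av ∧ (not tu ∧ not tv)) ⟧))
usable-split = from-yes
  (all-Bool? λ e → all-Bool? λ cu → all-Bool? λ cv → all-Bool? λ uv → all-Bool? λ ac → all-Bool? λ au → all-Bool? λ av →
    all-Bool? λ tc → all-Bool? λ tu → all-Bool? λ tv →
    ⟦ usable e cu cv uv au av ⟧ ≤?
      ⟦ tc ∧ usable e cu cv uv au av ⟧ +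
      ((⟦ tu ∧ usable e cu uv cv ac av ⟧ + ⟦ tu ∧ sparse-pair uv au av ⟧) +
      ((⟦ tv ∧ usable e cv uv cu ac au ⟧ + ⟦ tv ∧ sparse-pair uv av au ⟧) +
      ⟦ not tc ∧ (usable e cu cv uv au av ∧ (not tu ∧ not tv)) ⟧)))

-- Disjoint generalised stars in a symmetric ternary relation

copyVertices : (m h k : ℕ) → ℕ
copyVertices m h k = m * suc (h * suc k)

module _ (n m h k : ℕ) where

  private
    B : ℕ
    B = copyVertices m h k

  -- `sparseLink` bounds a link of maximum degree `B` without `h` disjoint stars. Occupying `B`
  -- vertices destroys at most `2 * (B * B)` ordered pairs of such a link, so one of size
  -- `linkThreshold` cannot become sparse. `apexBound` counts triples with apex among `m` arbitrary
  -- and `B` other vertices, the latter with links below the threshold. `usableBound` and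
  -- `edgeBound` follow the summands of `usable-split` and `charge`.
  sparseLink linkThreshold apexBound lostPairs usableBound edgeBound : ℕ
  sparseLink    = sparseBound n B h k
  linkThreshold = suc (2 * (B * B) + sparseLink)
  apexBound     = m * (n * n) + B * linkThreshold
  lostPairs     = m * n + (m * suc h) * (m * suc h)
  usableBound   = apexBound + ((apexBound + n * ((B + m) * h)) + ((apexBound + n * ((B + m) * h)) + n * sparseLink))
  edgeBound     = 3 * (n * lostPairs + (n * lostPairs + (n * (h * h) + usableBound)))

module _ {n : ℕ} (E : Fin n → Fin n → Fin n → Bool)
         (E-swap₁₂ : ∀ x y z → E x y z ≡ E y x z)
         (E-swap₂₃ : ∀ x y z → E x y z ≡ E x z y)
         (E-irr : ∀ x z → E x x z ≡ false) where

  GenStar : (h k : ℕ) → (StVert h k → Fin n) → Set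
  GenStar h k f = ∀ i j → E (f apex) (f (centre i)) (f (leaf i j)) ≡ true

  module _ (m h k : ℕ) where

    private
      B : ℕ
      B = copyVertices m h k

    -- `degree (E x) y` is the codegree of `x` and `y`.
    heavy : Fin n → Fin n → Bool
    heavy x y = B ≤ᵇ degree (E x) y

    heavy-sym : ∀ x y → heavy x y ≡ heavy y x
    heavy-sym x y = cong (B ≤ᵇ_) (sum-cong-≗ λ z → cong ⟦_⟧ (E-swap₁₂ x y z))

    fill-leaves : Stars heavy m h [] → Family m (StVert h k) (λ _ → GenStar h k) []
    fill-leaves (F , F-inj , _ , F-heavy) = H , H-inj , (λ _ ()) , proj₂ (proj₂ (proj₂ leaves))
      where
      e : Enum (Fin m × Maybe (Fin h)) (m * suc h)
      e = enum-× m (enum-Maybe (enum-Fin h))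

      regroup : ∀ m h k → m * suc h + m * (h * k) ≡ m * suc (h * suc k)
      regroup = solve-∀

      fits : length (image e F) + m * (h * k) ≤ B
      fits = ≤-reflexive (trans (cong (_+ m * (h * k)) (length-image e F)) (regroup m h k))

      leaves : Family m (Fin h × Fin k) (λ j f → ∀ i l → E (F (j , nothing)) (F (j , just i)) (f (i , l)) ≡ true) (image e F)
      leaves = choose-each (enum-× h (enum-Fin k)) m
        (λ j → choose-each (enum-Fin k) h λ i Z le →
          pick (E (F (j , nothing)) (F (j , just i))) Z k (≤-trans le (≤ᵇ⇒≤ B _ (subst T (sym (F-heavy j i)) _))))
        (image e F) fits

      G : Fin m × (Fin h × Fin k) → Fin n
      G = proj₁ leaves

      G-inj : Injective _≡_ _≡_ G
      G-inj = proj₁ (proj₂ leaves)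

      G∉ : ∀ y → G y ∉ image e F
      G∉ = proj₁ (proj₂ (proj₂ leaves))

      F≢G : ∀ x y → ¬ F x ≡ G y
      F≢G x y eq = G∉ y (subst (_∈ image e F) eq (∈-image e F x))

      H : Fin m × StVert h k → Fin n
      H (j , apex)     = F (j , nothing)
      H (j , centre i) = F (j , just i)
      H (j , leaf i l) = G (j , i , l)

      H-inj : Injective _≡_ _≡_ H
      H-inj {j , apex}     {_ , apex}     eq with refl ← F-inj eq = refl
      H-inj {j , apex}     {_ , centre _} eq with () ← F-inj eq
      H-inj {j , centre i} {_ , apex}     eq with () ← F-inj eq
      H-inj {j , centre i} {_ , centre _} eq with refl ← F-inj eq = refl
      H-inj {j , leaf i l} {_ , leaf _ _} eq with refl ← G-inj eq = refl
      H-inj {j , apex}     {_ , leaf _ _} eq = ⊥-elim (F≢G _ _ eq)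
      H-inj {j , centre i} {_ , leaf _ _} eq = ⊥-elim (F≢G _ _ eq)
      H-inj {j , leaf i l} {_ , apex}     eq = ⊥-elim (F≢G _ _ (sym eq))
      H-inj {j , leaf i l} {_ , centre _} eq = ⊥-elim (F≢G _ _ (sym eq))

    module _ (1≤m : 1 ≤ m) (1≤k : 1 ≤ k) where

      -- A loop has codegree 0, below the threshold because `1 ≤ m` makes `B` positive.
      heavy-irr : ∀ x → heavy x x ≡ false
      heavy-irr x with heavy x x in eq
      ... | false = refl
      ... | true  = contradiction (≤-trans 1≤B (≤-trans (≤ᵇ⇒≤ B _ (subst T (sym eq) _)) loop)) λ ()
        where
        1≤B : 1 ≤ B
        1≤B = *-mono-≤ 1≤m (s≤s z≤n)

        loop : degree (E x) x ≤ 0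
        loop = ∑-≤0 (λ z → ⟦ E x x z ⟧) (λ z → ≤-reflexive (cong ⟦_⟧ (E-irr x z)))

      -- Links of usable triples

      module _ (A : List (Fin n)) (A-sparse : ∀ x → x ∉ A → ∑ (λ y → ⟦ heavy x y ∧ y ∉ᵇ A ⟧) ≤ h) where

        -- `K c` is the part of the link graph of `c` for which `c` may serve as apex.
        K : Fin n → Fin n → Fin n → Bool
        K c u v = usable (E c u v) (heavy c u) (heavy c v) (heavy u v) (u ∈ᵇ A) (v ∈ᵇ A)

        S : Fin n → Fin n → Bool
        S c u = sparse-pair (heavy c u) (c ∈ᵇ A) (u ∈ᵇ A)

        degree-S : ∀ x → degree S x ≤ h
        degree-S x with x ∈ᵇ A in eq
        ... | true  = ≤-trans (∑-≤0 {n} (λ _ → 0) (λ _ → z≤n)) z≤n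
        ... | false = A-sparse x (∉ᵇ⇒∉ (cong not eq))

        K-sym : ∀ c u v → K c u v ≡ K c v u
        K-sym c u v rewrite E-swap₂₃ c u v | heavy-sym u v = usable-sym (E c v u) (heavy c u) (heavy c v) (heavy v u) (u ∈ᵇ A) (v ∈ᵇ A)

        K⊆E : ∀ c u v → K c u v ≡ true → E c u v ≡ true
        K⊆E c u v = proj₁ ∘ ∧-elim

        E-distinct : ∀ x y z → E x y z ≡ true → ¬ y ≡ z × ¬ y ≡ x
        E-distinct x y z e = y≢z , y≢x
          where
          y≢z : ¬ y ≡ z
          y≢z refl with () ← trans (sym e) (trans (E-swap₁₂ x y y) (trans (E-swap₂₃ y x y) (E-irr y x)))

          y≢x : ¬ y ≡ x
          y≢x refl with () ← trans (sym e) (E-irr y z)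

        K-irr : ∀ c u → K c u u ≡ false
        K-irr c u with K c u u in eq
        ... | false = refl
        ... | true  = contradiction refl (proj₁ (E-distinct c u u (K⊆E c u u eq)))

        -- If the pair `c`, `u` is heavy then no triple through it is usable at `c`; if it is light,
        -- its codegree is below `B`.
        degree-K : ∀ c u → degree (K c) u ≤ B
        degree-K c u = ≤-trans (∑-mono λ v → ⟦⟧-mono {K c u v} {not (heavy c u) ∧ E c u v} (light v)) (≤-trans (∑-guard (not (heavy c u)) (E c u)) light-degree)
          where
          light : ∀ v → K c u v ≡ true → not (heavy c u) ∧ E c u v ≡ true
          light v e with E c u v | heavy c u
          light v e | true | false = refl

          light-degree : ⟦ not (heavy c u) ⟧ * degree (E c) u ≤ B
          light-degree with heavy c u in eq
          ... | true  = z≤n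
          ... | false = ≤-trans (≤-reflexive (+-identityʳ _)) (<⇒≤ (≰⇒> λ B≤ → subst T eq (≤⇒≤ᵇ B≤)))

        LinkStars : Fin n → (Fin h × Maybe (Fin k) → Fin n) → Set
        LinkStars r f = ∀ i → Rooted (Star (K r)) λ x → f (i , x)

        SparseLink : Fin n → List (Fin n) → Set
        SparseLink r Z = ∑ (degree (restrict Z (K r))) ≤ sparseLink n m h k

        -- The stars must avoid `r` as well as `Z`; upon failure the bound for `r ∷ Z` is already
        -- one for `Z`, since `r` is isolated in its own link.
        find-link : ∀ r Z → Copy (Fin h × Maybe (Fin k)) (LinkStars r) (r ∷ Z) ⊎ SparseLink r Z
        find-link r Z with stars-outside (K r) (K-irr r) (K-sym r) (degree-K r) h k 1≤k (r ∷ Z)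
        ... | inj₁ c   = inj₁ c
        ... | inj₂ few = inj₂ (≤-trans (∑-mono λ x → ∑-mono λ y → ⟦⟧-mono {restrict Z (K r) x y} (keep x y)) few)
          where
          avoids : ∀ x → ¬ x ≡ r → x ∉ᵇ Z ≡ true → x ∉ᵇ (r ∷ Z) ≡ true
          avoids x x≢r x∉ = cong not (∉⇒∈ᵇ {x = x} {r ∷ Z} λ { (here x≡r) → x≢r x≡r ; (there x∈) → ∉ᵇ⇒∉ x∉ x∈ })

          keep : ∀ x y → restrict Z (K r) x y ≡ true → restrict (r ∷ Z) (K r) x y ≡ true
          keep x y e with ∧-elim {K r x y} e
          ... | Kxy , outside with ∧-elim {x ∉ᵇ Z} outside
          ...   | x∉ , y∉ = cong₂ _∧_ Kxy (cong₂ _∧_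
                  (avoids x (proj₂ (E-distinct r x y (K⊆E r x y Kxy))) x∉)
                  (avoids y (proj₂ (E-distinct r y x (K⊆E r y x (trans (K-sym r y x) Kxy)))) y∉))

        robust-link : ∀ r Z → (linkThreshold n m h k ≤ᵇ ∑ (degree (K r))) ≡ true → length Z + h * suc k ≤ B → ¬ SparseLink r Z
        robust-link r Z big le sparse = <-irrefl refl (begin-strict
          ∑ (degree (K r))                                                     ≤⟨ ∑₂-restrict (K r) (K-sym r) (degree-K r) Z ⟩
          ∑ (degree (restrict Z (K r))) + (length Z * B + length Z * B)        ≤⟨ +-mono-≤ sparse (+-mono-≤ Z*B≤ Z*B≤) ⟩
          sparseLink n m h k + (B * B + B * B)                                         ≡⟨ +-comm (sparseLink n m h k) _ ⟩
          B * B + B * B + sparseLink n m h k                                           ≡⟨ cong (λ t → B * B + t + sparseLink n m h k) (sym (+-identityʳ (B * B))) ⟩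
          2 * (B * B) + sparseLink n m h k                                             <⟨ n<1+n _ ⟩
          linkThreshold n m h k                                                        ≤⟨ ≤ᵇ⇒≤ (linkThreshold n m h k) _ (subst T (sym big) _) ⟩
          ∑ (degree (K r))                                                     ∎)
          where
          open ≤-Reasoning
          Z*B≤ : length Z * B ≤ B * B
          Z*B≤ = *-monoˡ-≤ B (≤-trans (m≤m+n (length Z) _) le)

        gen-star : Family m (Maybe (Fin h × Maybe (Fin k))) (λ _ → Rooted LinkStars) [] → Family m (StVert h k) (λ _ → GenStar h k) []
        gen-star (F , F-inj , _ , PF) = H , H-inj , (λ _ ()) , λ j i l → K⊆E _ _ _ (PF j i l)
          where
          φ : StVert h k → Maybe (Fin h × Maybe (Fin k))
          φ apex       = nothing
          φ (centre i) = just (i , nothing)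
          φ (leaf i l) = just (i , just l)

          φ-inj : Injective _≡_ _≡_ φ
          φ-inj {apex}     {apex}      refl = refl
          φ-inj {centre _} {centre _}  refl = refl
          φ-inj {leaf _ _} {leaf _ _}  refl = refl

          H : Fin m × StVert h k → Fin n
          H (j , x) = F (j , φ x)

          H-inj : Injective _≡_ _≡_ H
          H-inj {j , x} {j′ , x′} eq = cong₂ _,_ (cong proj₁ (F-inj eq)) (φ-inj (cong proj₂ (F-inj eq)))

        -- If the copies do not exist, a small set `U` of vertices is removed, outside which all
        -- links are sparse. A usable triple meeting `U` has a vertex of `U` which either can be its
        -- apex or lies in a heavy pair of the triple outside `A`.
        usable-bound : Family m (StVert h k) (λ _ → GenStar h k) [] ⊎ ∑₃ (λ c u v → ⟦ K c u v ⟧) ≤ usableBound n m h k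
        usable-bound with many-or-sparse (enum-× h (enum-Maybe (enum-Fin k))) LinkStars SparseLink find-link m
                            (λ r → linkThreshold n m h k ≤ᵇ ∑ (degree (K r))) robust-link
        ... | inj₁ F = inj₁ (gen-star F)
        ... | inj₂ (R , W , R≤ , W≤ , big∈R , sparse) = inj₂ (begin
          ∑₃ (λ c u v → ⟦ K c u v ⟧)
            ≤⟨ ∑₃-mono pointwise ⟩
          ∑₃ (λ c u v → J c u v + ((J u c v + N u v) + ((J v c u + N v u) + O c u v)))
            ≡⟨ distribute ⟩
          ∑₃ J + ((∑₃ (λ c u v → J u c v) + ∑₃ (λ c → N)) + ((∑₃ (λ c u v → J v c u) + ∑₃ (λ c u v → N v u)) + ∑₃ O))
            ≤⟨ +-mono-≤ J≤ (+-mono-≤ (+-mono-≤ (≤-trans (≤-reflexive (∑₃-swap₁₂ J)) J≤) N≤)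
                 (+-mono-≤ (+-mono-≤ (≤-trans (≤-reflexive (∑₃-rotate J)) J≤) N′≤) O≤)) ⟩
          usableBound n m h k ∎)
          where
          open ≤-Reasoning

          U : List (Fin n)
          U = W ++ R

          -- `J` counts triples with apex in `U` and `O` those missing `U`; `N` below counts the
          -- heavy pairs outside `A` that start in `U`, each extended by a free third vertex.
          J O : Fin n → Fin n → Fin n → ℕ
          J c u v = ⟦ c ∈ᵇ U ∧ K c u v ⟧
          O c u v = ⟦ c ∉ᵇ U ∧ restrict U (K c) u v ⟧

          N : Fin n → Fin n → ℕ
          N u v = ⟦ u ∈ᵇ U ∧ S u v ⟧

          pointwise : ∀ c u v → ⟦ K c u v ⟧ ≤ J c u v + ((J u c v + N u v) + ((J v c u + N v u) + O c u v))
          pointwise c u v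
            -- Symmetry turns the flags seen from `u` and `v` into those seen from `c`.
            rewrite E-swap₁₂ u c v | trans (E-swap₁₂ v c u) (E-swap₂₃ c v u)
                  | heavy-sym u c | heavy-sym v c | heavy-sym v u
            = usable-split (E c u v) (heavy c u) (heavy c v) (heavy u v) (c ∈ᵇ A) (u ∈ᵇ A) (v ∈ᵇ A) (c ∈ᵇ U) (u ∈ᵇ U) (v ∈ᵇ U)

          distribute : ∑₃ (λ c u v → J c u v + ((J u c v + N u v) + ((J v c u + N v u) + O c u v))) ≡
            ∑₃ J + ((∑₃ (λ c u v → J u c v) + ∑₃ (λ c → N)) + ((∑₃ (λ c u v → J v c u) + ∑₃ (λ c u v → N v u)) + ∑₃ O))
          distribute = trans (∑₃-+ J _) (cong (∑₃ J +_)
            (trans (∑₃-+ (λ c u v → J u c v + N u v) _) (cong₂ _+_ (∑₃-+ (λ c u v → J u c v) _)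
              (trans (∑₃-+ (λ c u v → J v c u + N v u) O) (cong (_+ ∑₃ O) (∑₃-+ (λ c u v → J v c u) _))))))

          J≤ : ∑₃ J ≤ apexBound n m h k
          J≤ = begin
            ∑₃ J
              ≤⟨ (∑-mono λ c → ≤-trans (∑-mono λ u → ∑-guard (c ∈ᵇ U) (K c u)) (pull c)) ⟩
            ∑ (λ c → ⟦ c ∈ᵇ U ⟧ * ∑ (degree (K c)))
              ≤⟨ ∑-over-++ W R (λ c → ∑ (degree (K c))) trivial small ⟩
            length R * (n * n) + length W * linkThreshold n m h k
              ≤⟨ +-mono-≤ (*-monoˡ-≤ (n * n) R≤) (*-monoˡ-≤ (linkThreshold n m h k) W≤) ⟩
            apexBound n m h k ∎
            where
            pull : ∀ c → ∑ (λ u → ⟦ c ∈ᵇ U ⟧ * degree (K c) u) ≤ ⟦ c ∈ᵇ U ⟧ * ∑ (degree (K c))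
            pull c = ≤-reflexive (begin-equality
              ∑ (λ u → ⟦ c ∈ᵇ U ⟧ * degree (K c) u)   ≡⟨ sum-cong-≗ (λ u → *-comm ⟦ c ∈ᵇ U ⟧ (degree (K c) u)) ⟩
              ∑ (λ u → degree (K c) u * ⟦ c ∈ᵇ U ⟧)   ≡⟨ ∑-*ʳ (degree (K c)) ⟦ c ∈ᵇ U ⟧ ⟩
              ∑ (degree (K c)) * ⟦ c ∈ᵇ U ⟧           ≡⟨ *-comm (∑ (degree (K c))) ⟦ c ∈ᵇ U ⟧ ⟩
              ⟦ c ∈ᵇ U ⟧ * ∑ (degree (K c))           ∎)

            trivial : ∀ c → ∑ (degree (K c)) ≤ n * n
            trivial c = ∑-≤-const λ u → ≤-trans (∑-≤-const λ v → ⟦⟧≤1 (K c u v)) (≤-reflexive (*-identityʳ n))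

            small : ∀ c → c ∉ R → ∑ (degree (K c)) ≤ linkThreshold n m h k
            small c c∉R with linkThreshold n m h k ≤? ∑ (degree (K c)) in eq
            ... | yes _  = contradiction (big∈R c (cong does eq)) c∉R
            ... | no big = <⇒≤ (≰⇒> big)

          ∑₂N≤ : ∑₂ N ≤ (B + m) * h
          ∑₂N≤ = begin
            ∑₂ N                                          ≤⟨ edges-touching S U ⟩
            ∑ (λ u → ⟦ u ∈ᵇ U ⟧ * degree S u)             ≤⟨ ∑-over U (degree S) degree-S ⟩
            length U * h                                  ≡⟨ cong (_* h) (length-++ W) ⟩
            (length W + length R) * h                     ≤⟨ *-monoˡ-≤ h (+-mono-≤ W≤ R≤) ⟩
            (B + m) * h                                   ∎

          N≤ : ∑₃ (λ c → N) ≤ n * ((B + m) * h)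
          N≤ = ≤-trans (∑₃-const₁ N) (*-monoʳ-≤ n ∑₂N≤)

          N′≤ : ∑₃ (λ c u v → N v u) ≤ n * ((B + m) * h)
          N′≤ = ≤-trans (≤-reflexive (∑₃-swap₂₃ (λ c → N))) N≤

          O≤ : ∑₃ O ≤ n * sparseLink n m h k
          O≤ = ∑-≤-const outside
            where
            outside : ∀ c → ∑₂ (O c) ≤ sparseLink n m h k
            outside c with c ∈ᵇ U in eq
            ... | true  = ≤-trans (∑-≤0 {n} (λ u → ∑ {n} λ v → 0) (λ u → ∑-≤0 {n} (λ _ → 0) (λ _ → z≤n))) z≤n
            ... | false = sparse c (∉ᵇ⇒∉ (cong not eq))

      -- Disjoint heavy stars extend to copies. Otherwise every triple is charged to one of its
      -- vertices, and by symmetry the three positions contribute equally, which gives the factor 3.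
      gen-stars-or-few-triples : Family m (StVert h k) (λ _ → GenStar h k) [] ⊎ ∑₃ (λ x y z → ⟦ E x y z ⟧) ≤ edgeBound n m h k
      gen-stars-or-few-triples with stars-or-sparse heavy heavy-irr {n} heavy≤n m h
        where
        heavy≤n : ∀ x → degree heavy x ≤ n
        heavy≤n x = ≤-trans (∑-≤-const λ y → ⟦⟧≤1 (heavy x y)) (≤-reflexive (*-identityʳ n))
      ... | inj₁ stars = inj₁ (fill-leaves stars)
      ... | inj₂ (A , touching , A-sparse) with usable-bound A A-sparse
      ...   | inj₁ F  = inj₁ F
      ...   | inj₂ K≤ = inj₂ (begin
          ∑₃ (λ x y z → ⟦ E x y z ⟧)
            ≤⟨ ∑₃-mono pointwise ⟩
          ∑₃ (λ x y z → Ψ x y z + (Ψ y x z + Ψ z x y))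
            ≡⟨ trans (∑₃-+ Ψ _) (cong (∑₃ Ψ +_) (∑₃-+ (λ x y z → Ψ y x z) _)) ⟩
          ∑₃ Ψ + (∑₃ (λ x y z → Ψ y x z) + ∑₃ (λ x y z → Ψ z x y))
            ≡⟨ cong₂ (λ s t → ∑₃ Ψ + (s + t)) (∑₃-swap₁₂ Ψ) (trans (∑₃-rotate Ψ) (sym (+-identityʳ _))) ⟩
          3 * ∑₃ Ψ
            ≤⟨ *-monoʳ-≤ 3 Ψ≤ ⟩
          edgeBound n m h k ∎)
        where
        open ≤-Reasoning

        Ψ : Fin n → Fin n → Fin n → ℕ
        Ψ c u v = charge (E c u v) (heavy c u) (heavy c v) (heavy u v) (c ∈ᵇ A) (u ∈ᵇ A) (v ∈ᵇ A)

        pointwise : ∀ x y z → ⟦ E x y z ⟧ ≤ Ψ x y z + (Ψ y x z + Ψ z x y)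
        pointwise x y z
          rewrite E-swap₁₂ y x z | trans (E-swap₁₂ z x y) (E-swap₂₃ x z y)
                | heavy-sym y x | heavy-sym z x | heavy-sym z y
          = charge-covers (E x y z) (heavy x y) (heavy x z) (heavy y z) (x ∈ᵇ A) (y ∈ᵇ A) (z ∈ᵇ A)

        L : Fin n → Fin n → ℕ
        L c u = ⟦ c ∈ᵇ A ∧ heavy c u ⟧

        D : Fin n → Fin n → Fin n → ℕ
        D c u v = ⟦ S A A-sparse c u ∧ S A A-sparse c v ⟧

        L≤ : ∑₃ (λ c u v → L c u) ≤ n * lostPairs n m h k
        L≤ = ≤-trans (∑₃-const₃ L) (*-monoʳ-≤ n (≤-trans (edges-touching heavy A) touching))

        D≤ : ∑₃ D ≤ n * (h * h)
        D≤ = ∑-≤-const λ c → begin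
          ∑₂ (D c)
            ≤⟨ (∑-mono λ u → ≤-trans (∑-guard (S A A-sparse c u) (S A A-sparse c)) (*-monoʳ-≤ ⟦ S A A-sparse c u ⟧ (degree-S A A-sparse c))) ⟩
          ∑ (λ u → ⟦ S A A-sparse c u ⟧ * h)
            ≡⟨ ∑-*ʳ (λ u → ⟦ S A A-sparse c u ⟧) h ⟩
          degree (S A A-sparse) c * h
            ≤⟨ *-monoˡ-≤ h (degree-S A A-sparse c) ⟩
          h * h ∎

        Ψ≤ : ∑₃ Ψ ≤ n * lostPairs n m h k +
                    (n * lostPairs n m h k + (n * (h * h) + usableBound n m h k))
        Ψ≤ = ≤-trans
          (≤-reflexive (trans (∑₃-+ (λ c u v → L c u) _) (cong (∑₃ (λ c u v → L c u) +_)
            (trans (∑₃-+ (λ c u v → L c v) _) (cong (∑₃ (λ c u v → L c v) +_) (∑₃-+ D _))))))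
          (+-mono-≤ L≤ (+-mono-≤ (≤-trans (≤-reflexive (∑₃-swap₂₃ (λ c u v → L c u))) L≤) (+-mono-≤ D≤ K≤)))

-- Numerical estimates

module _ (b Q : ℕ) where

  -- With s = a/b and `Q = a * (n * n)` this reads t ≤ c s n², cleared of the denominator.
  record _≼_ (t c : ℕ) : Set where
    constructor scaled
    field unscaled : t * b ≤ c * Q

  open _≼_ public

module _ {b Q : ℕ} where

  ≼-+ : ∀ {s t c d} → _≼_ b Q s c → _≼_ b Q t d → _≼_ b Q (s + t) (c + d)
  ≼-+ {s} {t} {c} {d} (scaled p) (scaled q) = scaled (begin
    (s + t) * b    ≡⟨ *-distribʳ-+ b s t ⟩
    s * b + t * b  ≤⟨ +-mono-≤ p q ⟩
    c * Q + d * Q  ≡⟨ sym (*-distribʳ-+ Q c d) ⟩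
    (c + d) * Q    ∎)
    where open ≤-Reasoning

  ≼-* : ∀ r {t c} → _≼_ b Q t c → _≼_ b Q (r * t) (r * c)
  ≼-* r {t} {c} (scaled p) = scaled (begin
    r * t * b    ≡⟨ *-assoc r t b ⟩
    r * (t * b)  ≤⟨ *-monoʳ-≤ r p ⟩
    r * (c * Q)  ≡⟨ sym (*-assoc r c Q) ⟩
    r * c * Q    ∎)
    where open ≤-Reasoning

  ≼-mono : ∀ {s t c} → s ≤ t → _≼_ b Q t c → _≼_ b Q s c
  ≼-mono s≤t (scaled p) = scaled (≤-trans (*-monoˡ-≤ b s≤t) p)

square-cancel-≤ : ∀ {x y} → x * x ≤ y * y → x ≤ y
square-cancel-≤ {x} {y} le with x ≤? y
... | yes x≤y = x≤y
... | no x≰y  = contradiction (≤-trans (*-mono-< (≰⇒> x≰y) (≰⇒> x≰y)) le) (<-irrefl refl)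

cube-cancel-≤ : ∀ {x y} → x * x * x ≤ y * y * y → x ≤ y
cube-cancel-≤ {x} {y} le with x ≤? y
... | yes x≤y = x≤y
... | no x≰y  = contradiction (≤-trans (*-mono-< (*-mono-< (≰⇒> x≰y) (≰⇒> x≰y)) (≰⇒> x≰y)) le) (<-irrefl refl)

-- For s = a/b the last six hypotheses read k ≤ s, h²k² ≤ sn, m ≤ s, m²h² ≤ sn, (mhk)³ ≤ sn² and s ≤
-- n. Each summand of `edgeBound` is reduced to a constant multiple of sn².
module Estimates (n m h k a b : ℕ) (1≤m : 1 ≤ m) (1≤h : 1 ≤ h) (1≤k : 1 ≤ k) (1≤b : 1 ≤ b)
                 (kb≤a : k * b ≤ a) (hk≤ : h * k * (h * k) * b ≤ a * n) (mb≤a : m * b ≤ a)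
                 (mh≤ : m * h * (m * h) * b ≤ a * n)
                 (N³≤ : m * (h * k) * (m * (h * k)) * (m * (h * k)) * b ≤ a * (n * n))
                 (a≤nb : a ≤ n * b) where

  open ≤-Reasoning

  Q N V : ℕ
  Q = a * (n * n)
  N = m * (h * k)
  V = copyVertices m h k

  infix 4 _⊑_
  _⊑_ : ℕ → ℕ → Set
  _⊑_ = _≼_ b Q

  by : ∀ {t u} → t * b ≡ u → u ≤ Q → t ⊑ 1
  by refl le = scaled (≤-trans le (≤-reflexive (sym (+-identityʳ Q))))

  -- The cube of `N` is at most sn², which is at most n³ because s ≤ n.
  N≤n : N ≤ n
  N≤n = cube-cancel-≤ (*-cancelʳ-≤ _ _ b {{>-nonZero 1≤b}} (begin
    N * N * N * b      ≤⟨ N³≤ ⟩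
    a * (n * n)        ≤⟨ *-monoˡ-≤ (n * n) a≤nb ⟩
    n * b * (n * n)    ≡⟨ regroup n b ⟩
    n * n * n * b      ∎))
    where
    regroup : ∀ n b → n * b * (n * n) ≡ n * n * n * b
    regroup = solve-∀

  -- The square of the left-hand side is the product of the left-hand sides of hk≤ and mh≤.
  mhhk≤ : m * (h * k) * h * b ≤ a * n
  mhhk≤ = square-cancel-≤ (begin
    m * (h * k) * h * b * (m * (h * k) * h * b)                ≡⟨ regroup m h k b ⟩
    (m * h * (m * h) * b) * (h * k * (h * k) * b)              ≤⟨ *-mono-≤ mh≤ hk≤ ⟩
    a * n * (a * n)                                            ∎)
    where
    regroup : ∀ m h k b → m * (h * k) * h * b * (m * (h * k) * h * b) ≡ (m * h * (m * h) * b) * (h * k * (h * k) * b)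
    regroup = solve-∀

  term-m : m * (n * n) ⊑ 1
  term-m = by (regroup m n b) (*-monoˡ-≤ (n * n) mb≤a)
    where
    regroup : ∀ m n b → m * (n * n) * b ≡ m * b * (n * n)
    regroup = solve-∀

  term-k : n * (n * k) ⊑ 1
  term-k = by (regroup k n b) (*-monoˡ-≤ (n * n) kb≤a)
    where
    regroup : ∀ k n b → n * (n * k) * b ≡ k * b * (n * n)
    regroup = solve-∀

  n*-term : ∀ {t} → t * b ≤ a * n → n * t ⊑ 1
  n*-term {t} le = scaled (begin
    n * t * b          ≡⟨ *-assoc n t b ⟩
    n * (t * b)        ≤⟨ *-monoʳ-≤ n le ⟩
    n * (a * n)        ≡⟨ regroup n a ⟩
    1 * (a * (n * n))  ∎)
    where
    regroup : ∀ n a → n * (a * n) ≡ 1 * (a * (n * n))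
    regroup = solve-∀

  term-mh : n * (m * h * (m * h)) ⊑ 1
  term-mh = n*-term mh≤

  term-hh : n * (h * h) ⊑ 1
  term-hh = ≼-mono (*-monoʳ-≤ n (*-mono-≤ h≤mh h≤mh)) term-mh
    where
    h≤mh : h ≤ m * h
    h≤mh = ≤-trans (≤-reflexive (sym (*-identityˡ h))) (*-monoˡ-≤ h 1≤m)

  term-hk : n * (h * k * (h * k)) ⊑ 1
  term-hk = n*-term hk≤

  term-Nh : n * (N * h) ⊑ 1
  term-Nh = n*-term mhhk≤

  term-N³ : N * N * N ⊑ 1
  term-N³ = by refl N³≤

  term-Nk : N * (n * k) ⊑ 1
  term-Nk = by (regroup N n k b) (begin
    N * n * (k * b)  ≤⟨ *-mono-≤ (*-monoˡ-≤ n N≤n) kb≤a ⟩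
    n * n * a        ≡⟨ *-comm (n * n) a ⟩
    a * (n * n)      ∎)
    where
    regroup : ∀ N n k b → N * (n * k) * b ≡ N * n * (k * b)
    regroup = solve-∀

  suc≤2* : ∀ {x} → 1 ≤ x → suc x ≤ 2 * x
  suc≤2* {x} 1≤x = ≤-trans (+-monoˡ-≤ x 1≤x) (≤-reflexive (cong (x +_) (sym (+-identityʳ x))))

  hk′≤ : h * suc k ≤ 2 * (h * k)
  hk′≤ = ≤-trans (*-monoʳ-≤ h (suc≤2* 1≤k)) (≤-reflexive (regroup h k))
    where
    regroup : ∀ h k → h * (2 * k) ≡ 2 * (h * k)
    regroup = solve-∀

  mh′≤ : m * suc h ≤ 2 * (m * h)
  mh′≤ = ≤-trans (*-monoʳ-≤ m (suc≤2* 1≤h)) (≤-reflexive (regroup m h))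
    where
    regroup : ∀ m h → m * (2 * h) ≡ 2 * (m * h)
    regroup = solve-∀

  -- Since `h` and `k` are positive, 1 ≤ hk and h(1 + k) ≤ 2hk.
  V≤3N : V ≤ 3 * N
  V≤3N = ≤-trans (*-monoʳ-≤ m (+-mono-≤ (*-mono-≤ 1≤h 1≤k) hk′≤)) (≤-reflexive (regroup m h k))
    where
    regroup : ∀ m h k → m * (h * k + 2 * (h * k)) ≡ 3 * (m * (h * k))
    regroup = solve-∀

  hk′≤V : h * suc k ≤ V
  hk′≤V = ≤-trans (n≤1+n _) (≤-trans (≤-reflexive (sym (*-identityˡ _))) (*-monoˡ-≤ _ 1≤m))

  h≤V : h ≤ V
  h≤V = ≤-trans (≤-trans (≤-reflexive (sym (*-identityʳ h))) (*-monoʳ-≤ h (s≤s z≤n))) hk′≤V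

  m≤V : m ≤ V
  m≤V = ≤-trans (≤-reflexive (sym (*-identityʳ m))) (*-monoʳ-≤ m (s≤s z≤n))

  1≤V : 1 ≤ V
  1≤V = ≤-trans 1≤m m≤V

  -- Here 7 = 1 + 2 + 4: the unit, the destroyed pairs, and twice the two products in `sparseBound`,
  -- each at most `V * V`.
  threshold≤ : linkThreshold n m h k ≤ 7 * (V * V) + n * k
  threshold≤ = begin
    1 + (2 * (V * V) + (2 * (h * V + h * suc k * (h * suc k)) + n * k))
      ≤⟨ +-mono-≤ (*-mono-≤ 1≤V 1≤V) (+-monoʳ-≤ (2 * (V * V)) (+-monoˡ-≤ (n * k)
           (*-monoʳ-≤ 2 (+-mono-≤ (*-monoˡ-≤ V h≤V) (*-mono-≤ hk′≤V hk′≤V))))) ⟩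
    V * V + (2 * (V * V) + (2 * (V * V + V * V) + n * k))
      ≡⟨ regroup (V * V) (n * k) ⟩
    7 * (V * V) + n * k ∎
    where
    regroup : ∀ x y → x + (2 * x + (2 * (x + x) + y)) ≡ 7 * x + y
    regroup = solve-∀

  -- From `V≤3N`, the constant is 7 · 27 for the cube of `N`, plus 3 for Nnk.
  V*threshold : V * linkThreshold n m h k ⊑ 192
  V*threshold = ≼-mono (begin
    V * linkThreshold n m h k                   ≤⟨ *-monoʳ-≤ V threshold≤ ⟩
    V * (7 * (V * V) + n * k)                      ≤⟨ *-mono-≤ V≤3N (+-monoˡ-≤ (n * k) (*-monoʳ-≤ 7 (*-mono-≤ V≤3N V≤3N))) ⟩
    3 * N * (7 * (3 * N * (3 * N)) + n * k)        ≡⟨ regroup N (n * k) ⟩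
    189 * (N * N * N) + 3 * (N * (n * k))          ∎)
    (≼-+ (≼-* 189 term-N³) (≼-* 3 term-Nk))
    where
    regroup : ∀ N y → 3 * N * (7 * (3 * N * (3 * N)) + y) ≡ 189 * (N * N * N) + 3 * (N * y)
    regroup = solve-∀

  removed-pairs : n * ((V + m) * h) ⊑ 6
  removed-pairs = ≼-mono (begin
    n * ((V + m) * h)              ≤⟨ *-monoʳ-≤ n (*-monoˡ-≤ h (+-mono-≤ V≤3N (≤-trans m≤V V≤3N))) ⟩
    n * ((3 * N + 3 * N) * h)      ≡⟨ regroup n N h ⟩
    6 * (n * (N * h))              ∎)
    (≼-* 6 term-Nh)
    where
    regroup : ∀ n N h → n * ((3 * N + 3 * N) * h) ≡ 6 * (n * (N * h))
    regroup = solve-∀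

  links : n * sparseLink n m h k ⊑ 15
  links = ≼-mono (begin
    n * (2 * (h * V + h * suc k * (h * suc k)) + n * k)
      ≤⟨ *-monoʳ-≤ n (+-monoˡ-≤ (n * k) (*-monoʳ-≤ 2 (+-mono-≤ (*-monoʳ-≤ h V≤3N) (*-mono-≤ hk′≤ hk′≤)))) ⟩
    n * (2 * (h * (3 * N) + 2 * (h * k) * (2 * (h * k))) + n * k)
      ≡⟨ regroup n h N (h * k) (n * k) ⟩
    6 * (n * (N * h)) + (8 * (n * (h * k * (h * k))) + n * (n * k)) ∎)
    (≼-+ (≼-* 6 term-Nh) (≼-+ (≼-* 8 term-hk) term-k))
    where
    regroup : ∀ n h N x y → n * (2 * (h * (3 * N) + 2 * x * (2 * x)) + y) ≡ 6 * (n * (N * h)) + (8 * (n * (x * x)) + n * y)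
    regroup = solve-∀

  lost : n * lostPairs n m h k ⊑ 5
  lost = ≼-mono (begin
    n * (m * n + m * suc h * (m * suc h))            ≤⟨ *-monoʳ-≤ n (+-monoʳ-≤ (m * n) (*-mono-≤ mh′≤ mh′≤)) ⟩
    n * (m * n + 2 * (m * h) * (2 * (m * h)))        ≡⟨ regroup n m (m * h) ⟩
    m * (n * n) + 4 * (n * (m * h * (m * h)))        ∎)
    (≼-+ term-m (≼-* 4 term-mh))
    where
    regroup : ∀ n m x → n * (m * n + 2 * x * (2 * x)) ≡ m * (n * n) + 4 * (n * (x * x))
    regroup = solve-∀

  edgeBound-scaled : edgeBound n m h k ⊑ 1851
  -- The constant is 3 · (5 + 5 + 1 + 193 + (193 + 6) + (193 + 6) + 15) = 1851.
  edgeBound-scaled = ≼-* 3 (≼-+ lost (≼-+ lost (≼-+ term-hh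
    (≼-+ apexes (≼-+ (≼-+ apexes removed-pairs) (≼-+ (≼-+ apexes removed-pairs) links))))))
    where
    apexes : apexBound n m h k ⊑ 193
    apexes = ≼-+ term-m V*threshold

-- Edges as triples of vertices

triple : Fin n → Fin n → Fin n → Subset n
triple x y z = ⁅ x ⁆ ∪ ⁅ y ⁆ ∪ ⁅ z ⁆

_≟ₛ_ : (e f : Subset n) → Dec (e ≡ f)
_≟ₛ_ = ≡-dec Bool._≟_

split-off : ∀ {c} (e : Subset n) → ∣ e ∣ ≡ suc c → ∃ λ x → ∃ λ e′ → e ≡ ⁅ x ⁆ ∪ e′ × ∣ e′ ∣ ≡ c
split-off (true  ∷ e) eq = zero , false ∷ e , cong (true ∷_) (sym (∪-identityˡ e)) , suc-injective eq
split-off (false ∷ e) eq with split-off e eq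
... | x , e′ , refl , card = suc x , false ∷ e′ , refl , card

card-0 : (e : Subset n) → ∣ e ∣ ≡ 0 → e ≡ ⊥
card-0 []          eq = refl
card-0 (false ∷ e) eq = cong (false ∷_) (card-0 e eq)

card-3 : (e : Subset n) → ∣ e ∣ ≡ 3 → ∃ λ x → ∃ λ y → ∃ λ z → triple x y z ≡ e
card-3 e eq with split-off e eq
... | x , e₁ , refl , eq₁ with split-off e₁ eq₁
...   | y , e₂ , refl , eq₂ with split-off e₂ eq₂
...     | z , e₃ , refl , eq₃ rewrite card-0 e₃ eq₃ | ∪-identityʳ ⁅ z ⁆ = x , y , z , refl

card-∪ : (e f : Subset n) → ∣ e ∪ f ∣ ≤ ∣ e ∣ + ∣ f ∣
card-∪ []          []          = z≤n
card-∪ (true  ∷ e) (true  ∷ f) = s≤s (≤-trans (card-∪ e f) (+-monoʳ-≤ ∣ e ∣ (n≤1+n ∣ f ∣)))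
card-∪ (true  ∷ e) (false ∷ f) = s≤s (card-∪ e f)
card-∪ (false ∷ e) (true  ∷ f) = ≤-trans (s≤s (card-∪ e f)) (≤-reflexive (sym (+-suc ∣ e ∣ ∣ f ∣)))
card-∪ (false ∷ e) (false ∷ f) = card-∪ e f

triple-swap₁₂ : (x y z : Fin n) → triple x y z ≡ triple y x z
triple-swap₁₂ {n} x y z = begin
  ⁅ x ⁆ ∪ (⁅ y ⁆ ∪ ⁅ z ⁆)  ≡⟨ ∪-assoc ⁅ x ⁆ ⁅ y ⁆ ⁅ z ⁆ ⟨
  (⁅ x ⁆ ∪ ⁅ y ⁆) ∪ ⁅ z ⁆  ≡⟨ cong (_∪ ⁅ z ⁆) (∪-comm ⁅ x ⁆ ⁅ y ⁆) ⟩
  (⁅ y ⁆ ∪ ⁅ x ⁆) ∪ ⁅ z ⁆  ≡⟨ ∪-assoc ⁅ y ⁆ ⁅ x ⁆ ⁅ z ⁆ ⟩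
  ⁅ y ⁆ ∪ (⁅ x ⁆ ∪ ⁅ z ⁆)  ∎
  where open ≡-Reasoning

triple-degenerate : (x z : Fin n) → ∣ triple x x z ∣ ≤ 2
triple-degenerate {n} x z = begin
  ∣ ⁅ x ⁆ ∪ (⁅ x ⁆ ∪ ⁅ z ⁆) ∣  ≡⟨ cong ∣_∣ (∪-assoc ⁅ x ⁆ ⁅ x ⁆ ⁅ z ⁆) ⟨
  ∣ (⁅ x ⁆ ∪ ⁅ x ⁆) ∪ ⁅ z ⁆ ∣  ≡⟨ cong (λ e → ∣ e ∪ ⁅ z ⁆ ∣) (∪-idem ⁅ x ⁆) ⟩
  ∣ ⁅ x ⁆ ∪ ⁅ z ⁆ ∣            ≤⟨ card-∪ ⁅ x ⁆ ⁅ z ⁆ ⟩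
  ∣ ⁅ x ⁆ ∣ + ∣ ⁅ z ⁆ ∣        ≡⟨ cong₂ _+_ (∣⁅x⁆∣≡1 x) (∣⁅x⁆∣≡1 z) ⟩
  2                            ∎
  where open ≤-Reasoning

module _ {n : ℕ} where
  open import Data.List.Membership.DecPropositional (_≟ₛ_ {n}) renaming (_∈?_ to _∈ₛ?_)

  -- Each edge is spanned by at least one ordered triple, and distinct edges by different triples.
  length≤triples : (es : List (Subset n)) → All (λ e → ∣ e ∣ ≡ 3) es → Unique es →
                   length es ≤ ∑₃ (λ x y z → ⟦ does (triple x y z ∈ₛ? es) ⟧)
  length≤triples []       _            _            = z≤n
  length≤triples (e ∷ es) (card ∷ cards) (e∉es ∷ uniq) with card-3 e card
  ... | a , b , c , abc≡e = begin
    1 + length es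
      ≤⟨ +-mono-≤ hit (length≤triples es cards uniq) ⟩
    ∑₃ (λ x y z → ⟦ does (triple x y z ≟ₛ e) ⟧) + ∑₃ (λ x y z → ⟦ does (triple x y z ∈ₛ? es) ⟧)
      ≡⟨ ∑₃-+ (λ x y z → ⟦ does (triple x y z ≟ₛ e) ⟧) (λ x y z → ⟦ does (triple x y z ∈ₛ? es) ⟧) ⟨
    ∑₃ (λ x y z → ⟦ does (triple x y z ≟ₛ e) ⟧ + ⟦ does (triple x y z ∈ₛ? es) ⟧)
      ≤⟨ ∑₃-mono (λ x y z → disjoint (triple x y z)) ⟩
    ∑₃ (λ x y z → ⟦ does (triple x y z ∈ₛ? (e ∷ es)) ⟧) ∎
    where
    open ≤-Reasoning

    hit : 1 ≤ ∑₃ (λ x y z → ⟦ does (triple x y z ≟ₛ e) ⟧)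
    hit = begin
      1                                                  ≡⟨ cong ⟦_⟧ (dec-true (triple a b c ≟ₛ e) abc≡e) ⟨
      ⟦ does (triple a b c ≟ₛ e) ⟧                       ≤⟨ term≤∑ (λ z → ⟦ does (triple a b z ≟ₛ e) ⟧) c ⟩
      ∑ (λ z → ⟦ does (triple a b z ≟ₛ e) ⟧)             ≤⟨ term≤∑ (λ y → ∑ λ z → ⟦ does (triple a y z ≟ₛ e) ⟧) b ⟩
      ∑₂ (λ y z → ⟦ does (triple a y z ≟ₛ e) ⟧)          ≤⟨ term≤∑ (λ x → ∑₂ λ y z → ⟦ does (triple x y z ≟ₛ e) ⟧) a ⟩
      ∑₃ (λ x y z → ⟦ does (triple x y z ≟ₛ e) ⟧)        ∎

    disjoint : ∀ f → ⟦ does (f ≟ₛ e) ⟧ + ⟦ does (f ∈ₛ? es) ⟧ ≤ ⟦ does (f ∈ₛ? (e ∷ es)) ⟧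
    disjoint f with f ≟ₛ e | f ∈ₛ? es
    ... | yes refl | yes e∈es = contradiction refl (All.lookup e∉es e∈es)
    ... | yes _    | no _     = ≤-refl
    ... | no _     | yes _    = ≤-refl
    ... | no _     | no _     = ≤-refl

  edge : ThreeGraph n → Fin n → Fin n → Fin n → Bool
  edge G x y z = does (triple x y z ∈ₛ? edges G)

  edge⇒HasEdge : ∀ G x y z → edge G x y z ≡ true → HasEdge G x y z
  edge⇒HasEdge G x y z eq with triple x y z ∈ₛ? edges G
  ... | yes e∈ = e∈

  edge-swap₁₂ : ∀ G x y z → edge G x y z ≡ edge G y x z
  edge-swap₁₂ G x y z = cong (λ e → does (e ∈ₛ? edges G)) (triple-swap₁₂ x y z)

  edge-swap₂₃ : ∀ G x y z → edge G x y z ≡ edge G x z y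
  edge-swap₂₃ G x y z = cong (λ e → does (⁅ x ⁆ ∪ e ∈ₛ? edges G)) (∪-comm ⁅ y ⁆ ⁅ z ⁆)

  edge-irr : ∀ G x z → edge G x x z ≡ false
  edge-irr G x z = dec-false (triple x x z ∈ₛ? edges G) λ e∈ →
    contradiction (≤-trans (≤-reflexive (sym (All.lookup (uniform G) e∈))) (triple-degenerate x z)) λ { (s≤s (s≤s ())) }

  numEdges≤triples : ∀ G → numEdges G ≤ ∑₃ (λ x y z → ⟦ edge G x y z ⟧)
  numEdges≤triples G = length≤triples (edges G) (uniform G) (simple G)

-- This trivial bound, compared with the assumed number of edges, yields s ≤ n.
numEdges≤n³ : (G : ThreeGraph n) → numEdges G ≤ n * (n * n)
numEdges≤n³ {n} G = ≤-trans (numEdges≤triples G)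
  (∑-≤-const λ x → ∑-≤-const λ y → ≤-trans (∑-≤-const λ z → ⟦⟧≤1 (edge G x y z)) (≤-reflexive (*-identityʳ n)))

-- From triples back to 3-graphs

disjoint-stars : ∀ {h k m} (G : ThreeGraph n) →
                 Family m (StVert h k) (λ _ → GenStar (edge G) (edge-swap₁₂ G) (edge-swap₂₃ G) (edge-irr G) h k) [] →
                 DisjointStars G h k m
disjoint-stars G (F , F-inj , _ , PF) =
  (λ c x → F (c , x)) ,
  (λ eq → cong proj₁ (F-inj eq) , cong proj₂ (F-inj eq)) ,
  (λ c i j → edge⇒HasEdge G _ _ _ (PF c i j))

-- The real parameter s is represented by a fraction a/b, and t by an arbitrary natural number `m`
-- with m ≤ t: the three conditions on `m` are its comparisons with the terms of the minimum, freed
-- of roots and denominators.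
theorem5p2 : ∃[ C ] (∀ (n h k a b : ℕ) → 1 ≤ n → 1 ≤ h → 1 ≤ k → 1 ≤ b →
    k * b ≤ a →
    h ^ 2 * k ^ 2 * b ≤ a * n →
    (G : ThreeGraph n) →
    C * a * n ^ 2 ≤ numEdges G * b →
    (m : ℕ) →
    m * b ≤ a →
    m ^ 2 * h ^ 2 * b ≤ a * n →
    m ^ 3 * h ^ 3 * k ^ 3 * b ≤ a * n ^ 2 →
    DisjointStars G h k m)
-- One more than the constant in `edgeBound-scaled`, so that the two bounds on the number of edges
-- contradict each other.
theorem5p2 = 1852 , go
  where
  go : ∀ (n h k a b : ℕ) → 1 ≤ n → 1 ≤ h → 1 ≤ k → 1 ≤ b → k * b ≤ a → h ^ 2 * k ^ 2 * b ≤ a * n →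
       (G : ThreeGraph n) → 1852 * a * n ^ 2 ≤ numEdges G * b → (m : ℕ) → m * b ≤ a →
       m ^ 2 * h ^ 2 * b ≤ a * n → m ^ 3 * h ^ 3 * k ^ 3 * b ≤ a * n ^ 2 → DisjointStars G h k m
  -- The estimates assume `1 ≤ m`; for `m = 0` the empty family serves.
  go n h k a b 1≤n 1≤h 1≤k 1≤b kb≤a hk≤ G many zero mb≤a mh≤ mhk≤ = (λ ()) , (λ { {()} }) , λ ()
  go n h k a b 1≤n 1≤h 1≤k 1≤b kb≤a hk≤ G many m@(suc _) mb≤a mh≤ mhk≤
    with gen-stars-or-few-triples (edge G) (edge-swap₁₂ G) (edge-swap₂₃ G) (edge-irr G) m h k (s≤s z≤n) 1≤k
  ... | inj₁ F   = disjoint-stars G F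
  ... | inj₂ few = contradiction 1852Q≤1851Q (<⇒≱ (*-monoˡ-< Q {{>-nonZero 0<Q}} {1851} (n<1+n 1851)))
    where
    open ≤-Reasoning

    Q : ℕ
    Q = a * (n * n)

    many′ : 1852 * Q ≤ numEdges G * b
    many′ = ≤-trans (≤-reflexive (regroup 1852 a n)) many
      where
      regroup : ∀ c a n → c * (a * (n * n)) ≡ c * a * (n * (n * 1))
      regroup = solve-∀

    0<Q : 0 < Q
    0<Q = *-mono-≤ (≤-trans (*-mono-≤ 1≤k 1≤b) kb≤a) (*-mono-≤ 1≤n 1≤n)

    -- This is s ≤ n, from sn² ≤ 1852sn² ≤ e ≤ n³.
    a≤nb : a ≤ n * b
    a≤nb = *-cancelʳ-≤ a (n * b) (n * n) {{>-nonZero (*-mono-≤ 1≤n 1≤n)}} (begin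
      a * (n * n)        ≤⟨ m≤m+n Q (1851 * Q) ⟩
      1852 * Q           ≤⟨ many′ ⟩
      numEdges G * b     ≤⟨ *-monoˡ-≤ b (numEdges≤n³ G) ⟩
      n * (n * n) * b    ≡⟨ regroup n b ⟩
      n * b * (n * n)    ∎)
      where
      regroup : ∀ n b → n * (n * n) * b ≡ n * b * (n * n)
      regroup = solve-∀

    square : ∀ x y b → x * y * (x * y) * b ≡ x * (x * 1) * (y * (y * 1)) * b
    square = solve-∀

    cube : ∀ m h k b → m * (h * k) * (m * (h * k)) * (m * (h * k)) * b ≡
                       m * (m * (m * 1)) * (h * (h * (h * 1))) * (k * (k * (k * 1))) * b
    cube = solve-∀

    module Est = Estimates n m h k a b (s≤s z≤n) 1≤h 1≤k 1≤b kb≤a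
      (≤-trans (≤-reflexive (square h k b)) hk≤) mb≤a
      (≤-trans (≤-reflexive (square m h b)) mh≤)
      (≤-trans (≤-reflexive (cube m h k b)) (≤-trans mhk≤ (≤-reflexive (cong (λ t → a * (n * t)) (*-identityʳ n)))))
      a≤nb

    1852Q≤1851Q : 1852 * Q ≤ 1851 * Q
    1852Q≤1851Q = begin
      1852 * Q                                ≤⟨ many′ ⟩
      numEdges G * b                          ≤⟨ *-monoˡ-≤ b (≤-trans (numEdges≤triples G) few) ⟩
      edgeBound n m h k * b                   ≤⟨ unscaled Est.edgeBound-scaled ⟩
      1851 * Q                                ∎
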